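{- Let $n$ be a positive odd integer, and let $x\in\mathbb{Z}$ with $\gcd(x(1-x),n)=1$. Then $$(-1)^{|\{1\le k<n/2:\ \{kx\}_n>k\}|}=\left(\frac{2x(1-x)}{n}\right).$$ Also, $$(-1)^{|\{1\le k<n/2:\ \{kx\}_n>n/2\ \&\ \{k(1-x)\}_n>n/2\}|}=\left(\frac{2}{n}\right),$$ $$(-1)^{|\{1\le k<n/2:\ \{kx\}_n<n/2\ \&\ \{k(1-x)\}_n<n/2\}|}=\left(\frac{2x(x-1)}{n}\right),$$ and $$(-1)^{|\{1\le k<n/2:\ \{kx\}_n>n/2>\{k(1-x)\}_n\}|}=\left(\frac{2x}{n}\right).$$
   Context: For a positive integer $n$ and an integer $y$, $\{y\}_n$ denotes the unique integer $r\in\{0,\dots,n-1\}$ with $r\equiv y\pmod n$. $\left(\frac{\cdot}{n}\right)$ denotes the Jacobi symbol. -}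

module Defs where

open import Data.Nat as ℕ using (ℕ; zero; suc; NonZero; _≡ᵇ_)
open import Data.Integer as ℤ using (ℤ; +_; -_; _%ℕ_; 0ℤ; 1ℤ; -1ℤ)
open import Data.Bool using (Bool; true; false; if_then_else_)
open import Data.List using (List; map; filter; length)
open import Data.Bool.ListAction using (any)
open import Data.List using (upTo)
open import Data.Nat.Primality.Factorisation using (factorise; factors)
open import Relation.Nullary using (Dec)
open import Relation.Unary using (Pred; Decidable)
open import Level using (0ℓ)

res : ℤ → (n : ℕ) → .{{NonZero n}} → ℕ
res y n = y %ℕ n

legendre : ℤ → (p : ℕ) → .{{NonZero p}} → ℤ
legendre a p =
  let r = a %ℕ p in
  if r ≡ᵇ 0 then 0ℤ
  else if any (λ y → ((y ℕ.* y) ℕ.% p) ≡ᵇ r) (upTo p) then 1ℤ else -1ℤ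

jacobi : ℤ → (n : ℕ) → .{{NonZero n}} → ℤ
jacobi a n = product' (map (λ p → legendreP a p) (factors (factorise n)))
  where
    product' : List ℤ → ℤ
    product' Data.List.[] = 1ℤ
    product' (x Data.List.∷ xs) = x ℤ.* product' xs
    -- primes are nonzero; for the (impossible) factor 0 return 0
    legendreP : ℤ → ℕ → ℤ
    legendreP a zero = 0ℤ
    legendreP a (suc p) = legendre a (suc p)

sgn : ℕ → ℤ
sgn m = -1ℤ ℤ.^ m

countHalf : (n : ℕ) → (P : Pred ℕ 0ℓ) → Decidable P → ℕ
countHalf n P P? = length (filter (λ k → P? k) (filter (λ k → ℕ._<?_ (2 ℕ.* k) n) (Data.List.map suc (upTo n))))

{-# OPTIONS --safe #-}

-- For odd n = 2h + 1 let G h a be the product over 0 ≤ k ≤ h of the signs of the least absolute residues of ka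
-- modulo n.  Reindexing this product makes G multiplicative in a and, after cutting {1, …, h} into blocks, in n;
-- Gauss's lemma together with the bound on the roots of x^h - 1 identifies G with the Legendre symbol for prime n,
-- hence with the Jacobi symbol for all odd n.
-- For the theorem let r = {kx} and s = {k(1-x)}, so that r + s is k or n + k, the latter exactly when r > k.
-- Modulo 2 this says that [r > k] is r + s + k, and the sign (-1)^{y} is the sign of the residue of y / 2; the
-- product over k therefore gives (2x(1-x) / n).  Since [r > k] is also the disjunction of r > n/2 and s > n/2,
-- the other three formulas follow.
module Submission where

open import Defs
open import Data.Bool using (Bool; true; false; T; if_then_else_)
open import Data.Bool.ListAction using (any)
open import Data.Empty using (⊥-elim)
open import Data.Fin using (Fin; toℕ; fromℕ<)
import Data.Fin.Properties as Fin
open import Data.Fin.Permutation using (permutation)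
open import Data.Integer as ℤ
  using (ℤ; +_; -[1+_]; _+_; _*_; -_; _-_; _^_; 0ℤ; 1ℤ; -1ℤ; ∣_∣; _%ℕ_; _/ℕ_)
import Data.Integer.Properties as ℤ
open import Data.Integer.DivMod using (n%ℕd<d; a≡a%ℕn+[a/ℕn]*n)
open import Data.Integer.Divisibility.Signed using (divides; ∣ᵤ⇒∣)
open import Data.Integer.Tactic.RingSolver using (solve-∀)
open import Data.List using (List; []; _∷_; upTo; applyUpTo; filter; length)
open import Data.List.Membership.Propositional using (lose)
open import Data.List.Membership.Propositional.Properties using (∈-upTo⁺)
open import Data.List.Properties using (map-applyUpTo)
open import Data.List.Relation.Unary.All using (All)
open import Data.List.Relation.Unary.Any using (satisfied)
open import Data.List.Relation.Unary.Any.Properties using (any⁺; any⁻)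
open import Data.Nat as ℕ using (ℕ; zero; suc; NonZero; _<_; _<?_; _≤_; _≤?_; s≤s; z≤n; _≡ᵇ_)
import Data.Nat.Coprimality as Coprimality
open import Data.Nat.Coprimality using (Coprime; coprime-Bézout; prime⇒coprime)
import Data.Nat.Divisibility as ℕ∣
import Data.Nat.DivMod as ℕ
open import Data.Nat.GCD using (module Bézout)
open import Data.Nat.ListAction using (product)
open import Data.Nat.Primality using (Prime; euclidsLemma; ¬prime[1])
open import Data.Nat.Primality.Factorisation using (factorise)
import Data.Nat.Properties as ℕ
import Data.Nat.Tactic.RingSolver as ℕ-Ring
open import Data.Product using (_×_; _,_; ∃; proj₁; proj₂)
open import Data.Sum using (_⊎_; inj₁; inj₂)
open import Data.Vec as Vec using (Vec)
open import Function using (_∘_; id)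
open import Level using (0ℓ)
open import Relation.Binary.PropositionalEquality
  using (_≡_; _≢_; refl; sym; trans; cong; cong₂; subst; module ≡-Reasoning)
open import Relation.Nullary using (¬_; yes; no; Dec; does)
open import Relation.Nullary.Decidable using (_×-dec_; dec-true; dec-false)
open import Relation.Unary using (Pred; Decidable)
open import Algebra.Properties.CommutativeMonoid.Sum ℤ.*-1-commutativeMonoid
  using (sum; sum-cong-≗; ∑-distrib-+; ∑-comm; sum-permute)

-- Gauss's argument cancels `h!`, which is not invertible modulo a composite `odd h`, so composite
-- moduli are reached only through multiplicativity of `G` in the modulus. There the obstacle is
-- that the half system {1, ..., w} modulo MN is no union of complete lifts of the half system
-- modulo M. In the class of ± t modulo M it contains t, and for 1 ≤ j ≤ v both jM + t and jM - t.
-- Negating the latter completes the N lifts of t, at the cost of (-1)^v. Among all N lifts the v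
-- upper ones have negative residues and give a second (-1)^v, and the two cancel. The factor (2/n)
-- comes from halving: h + 1 is the inverse of 2 modulo 2h + 1, so each parity read off as a sign
-- brings in one `G h (+ 2)`.

-- Congruences between integers

infix 4 _≈_[_]

-- The quotient is explicit and the equation is solved for `a`, so matching on `quot q refl` turns
-- every congruence law into a ring identity.
record _≈_[_] (a b : ℤ) (n : ℕ) : Set where
  constructor quot
  field
    quotient : ℤ
    equality : a ≡ b + quotient * + n

private
  variable
    a b c d y z : ℤ
    n m k : ℕ
    X : Set

≈-reflexive : a ≡ b → a ≈ b [ n ]
≈-reflexive {a} {n = n} refl = quot 0ℤ (lemma a (+ n))
  where
  lemma : ∀ a n → a ≡ a + 0ℤ * n
  lemma = solve-∀

≈-refl : a ≈ a [ n ]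
≈-refl = ≈-reflexive refl

≈-sym : a ≈ b [ n ] → b ≈ a [ n ]
≈-sym {b = b} {n} (quot q refl) = quot (- q) (lemma b q (+ n))
  where
  lemma : ∀ b q n → b ≡ b + q * n + - q * n
  lemma = solve-∀

≈-trans : a ≈ b [ n ] → b ≈ c [ n ] → a ≈ c [ n ]
≈-trans {n = n} {c} (quot q refl) (quot r refl) = quot (r + q) (lemma c q r (+ n))
  where
  lemma : ∀ c q r n → c + r * n + q * n ≡ c + (r + q) * n
  lemma = solve-∀

+-cong : a ≈ b [ n ] → c ≈ d [ n ] → a + c ≈ b + d [ n ]
+-cong {b = b} {n} {d = d} (quot q refl) (quot r refl) = quot (q + r) (lemma b d q r (+ n))
  where
  lemma : ∀ b d q r n → b + q * n + (d + r * n) ≡ b + d + (q + r) * n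
  lemma = solve-∀

*-cong : a ≈ b [ n ] → c ≈ d [ n ] → a * c ≈ b * d [ n ]
*-cong {b = b} {n} {d = d} (quot q refl) (quot r refl) =
  quot (q * d + b * r + q * r * + n) (lemma b d q r (+ n))
  where
  lemma : ∀ b d q r n →
    (b + q * n) * (d + r * n) ≡ b * d + (q * d + b * r + q * r * n) * n
  lemma = solve-∀

-‿cong : a ≈ b [ n ] → - a ≈ - b [ n ]
-‿cong {b = b} {n} (quot q refl) = quot (- q) (lemma b q (+ n))
  where
  lemma : ∀ b q n → - (b + q * n) ≡ - b + - q * n
  lemma = solve-∀

*-congˡ : ∀ c → a ≈ b [ n ] → c * a ≈ c * b [ n ]
*-congˡ c p = *-cong (≈-refl {c}) p

*-congʳ : ∀ c → a ≈ b [ n ] → a * c ≈ b * c [ n ]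
*-congʳ c p = *-cong p (≈-refl {c})

≈-scale : ∀ m → a ≈ b [ n ] → + m * a ≈ + m * b [ m ℕ.* n ]
≈-scale {b = b} {n} m (quot q refl) =
  quot q (trans (lemma (+ m) b q (+ n)) (cong (λ t → + m * b + q * t) (sym (ℤ.pos-* m n))))
  where
  lemma : ∀ m b q n → m * (b + q * n) ≡ m * b + q * (m * n)
  lemma = solve-∀

≈-multiple : ∀ q → a + q * + n ≈ a [ n ]
≈-multiple q = quot q refl

≈-factorˡ : ∀ m → a ≈ b [ m ℕ.* n ] → a ≈ b [ m ]
≈-factorˡ {b = b} {n} m (quot q refl) =
  quot (q * + n) (cong (λ t → b + t) (trans (cong (q *_) (ℤ.pos-* m n)) (lemma q (+ m) (+ n))))
  where
  lemma : ∀ q m n → q * (m * n) ≡ q * n * m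
  lemma = solve-∀

≈-factorʳ : ∀ m → a ≈ b [ m ℕ.* n ] → a ≈ b [ n ]
≈-factorʳ {a} {b} {n} m p = ≈-factorˡ n (subst (a ≈ b [_]) (ℕ.*-comm m n) p)

≈-% : ∀ a n .{{_ : NonZero n}} → a ≈ + (a %ℕ n) [ n ]
≈-% a n = quot (a /ℕ n) (a≡a%ℕn+[a/ℕn]*n a n)

-- A nonzero quotient would make the difference at least `n` in absolute value.
≈⇒≡ : ∣ a - b ∣ < n → a ≈ b [ n ] → a ≡ b
≈⇒≡ {b = b} {n} a-b<n (quot q refl) = go ∣ q ∣ refl
  where
  open ℕ.≤-Reasoning
  lemma : ∀ b t → t ≡ b + t - b
  lemma = solve-∀
  go : ∀ k → ∣ q ∣ ≡ k → b + q * + n ≡ b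
  go zero    ∣q∣≡0 rewrite ℤ.∣i∣≡0⇒i≡0 {q} ∣q∣≡0 = ℤ.+-identityʳ b
  go (suc k) ∣q∣≡1+k = ⊥-elim (ℕ.<⇒≱ a-b<n (begin
    n                    ≤⟨ ℕ.m≤m+n n (k ℕ.* n) ⟩
    suc k ℕ.* n          ≡⟨ cong (ℕ._* n) (sym ∣q∣≡1+k) ⟩
    ∣ q ∣ ℕ.* n          ≡⟨ sym (ℤ.abs-* q (+ n)) ⟩
    ∣ q * + n ∣          ≡⟨ cong ∣_∣ (lemma b (q * + n)) ⟩
    ∣ b + q * + n - b ∣  ∎))

-- Units modulo n

-- Coprimality is carried as a witness: cancelling is multiplying by the inverse, and the same
-- inverse serves modulo every factor of `n`.
Invertible : ℕ → ℤ → Set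
Invertible n a = ∃ λ a⁻¹ → a⁻¹ * a ≈ 1ℤ [ n ]

-- Bézout over ℕ inverts the absolute value, in either of its two orientations; the sign of `a` then
-- passes to the inverse.
coprime⇒invertible : ∀ a → Coprime ∣ a ∣ n → Invertible n a
coprime⇒invertible {n} a coprime = go a (ℤ.+∣i∣≡i⊎+∣i∣≡-i a)
  where
  invertible-∣∣ : Invertible n (+ ∣ a ∣)
  invertible-∣∣ with coprime-Bézout coprime
  ... | Bézout.+- x y eq = + x , quot (+ y) (trans (sym (ℤ.pos-* x ∣ a ∣))
          (trans (cong +_ (sym eq)) (cong (λ t → 1ℤ + t) (ℤ.pos-* y n))))
  ... | Bézout.-+ x y eq = - + x , quot (- + y) (lemma (+ x * + ∣ a ∣) (+ x) _ (+ y) (+ n) refl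
          (trans (cong (λ t → 1ℤ + t) (sym (ℤ.pos-* x ∣ a ∣))) (trans (cong +_ eq) (ℤ.pos-* y n))))
    where
    lemma₁ : ∀ x c → - x * c ≡ 1ℤ - (1ℤ + x * c)
    lemma₁ = solve-∀
    lemma₂ : ∀ y n → 1ℤ - y * n ≡ 1ℤ + - y * n
    lemma₂ = solve-∀
    lemma : ∀ t x c y n → t ≡ x * c → 1ℤ + t ≡ y * n → - x * c ≡ 1ℤ + - y * n
    lemma t x c y n refl e = trans (lemma₁ x c) (trans (cong (λ t → 1ℤ - t) e) (lemma₂ y n))
  go : ∀ a' → + ∣ a ∣ ≡ a' ⊎ + ∣ a ∣ ≡ - a' → Invertible n a'
  go a' (inj₁ e) = subst (Invertible n) e invertible-∣∣
  go a' (inj₂ e) with c , p ← invertible-∣∣ =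
    - c , ≈-trans (≈-reflexive (trans (lemma c a') (cong (c *_) (sym e)))) p
    where
    lemma : ∀ c a → - c * a ≡ c * (- a)
    lemma = solve-∀

invertible-* : Invertible n a → Invertible n b → Invertible n (a * b)
invertible-* {a = a} {b} (c , p) (d , q) =
  c * d , ≈-trans (≈-reflexive (lemma a b c d)) (*-cong p q)
  where
  lemma : ∀ a b c d → c * d * (a * b) ≡ c * a * (d * b)
  lemma = solve-∀

invertible-factorˡ : Invertible n (a * b) → Invertible n a
invertible-factorˡ {a = a} {b} (c , p) = c * b , ≈-trans (≈-reflexive (lemma a b c)) p
  where
  lemma : ∀ a b c → c * b * a ≡ c * (a * b)
  lemma = solve-∀

invertible-factorʳ : Invertible n (a * b) → Invertible n b
invertible-factorʳ {n} {a} {b} p = invertible-factorˡ (subst (Invertible n) (ℤ.*-comm a b) p)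

invertible-cancel : Invertible n a → a * b ≈ a * c [ n ] → b ≈ c [ n ]
invertible-cancel {a = a} {b} {c} (d , p) q =
  ≈-trans (≈-sym (unit b)) (≈-trans (*-congˡ d q) (unit c))
  where
  unit : ∀ b → d * (a * b) ≈ b [ _ ]
  unit b = ≈-trans (≈-reflexive (sym (ℤ.*-assoc d a b)))
    (≈-trans (*-congʳ b p) (≈-reflexive (ℤ.*-identityˡ b)))

-- Finite products

-- `sum` is instantiated at the multiplicative monoid of ℤ, so it denotes a product here.
∏ : ℕ → (ℕ → ℤ) → ℤ
∏ n f = sum (λ (i : Fin n) → f (toℕ i))

∏-cong : ∀ n {f g : ℕ → ℤ} → (∀ k → k < n → f k ≡ g k) → ∏ n f ≡ ∏ n g
∏-cong n f≡g = sum-cong-≗ (λ i → f≡g (toℕ i) (Fin.toℕ<n i))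

∏-cong-≈ : ∀ n {f g : ℕ → ℤ} → (∀ k → k < n → f k ≈ g k [ m ]) → ∏ n f ≈ ∏ n g [ m ]
∏-cong-≈ zero    f≈g = ≈-refl
∏-cong-≈ (suc n) f≈g = *-cong (f≈g 0 (s≤s z≤n)) (∏-cong-≈ n (λ k k<n → f≈g (suc k) (s≤s k<n)))

∏-distrib-* : ∀ n (f g : ℕ → ℤ) → ∏ n (λ k → f k * g k) ≡ ∏ n f * ∏ n g
∏-distrib-* n f g = ∑-distrib-+ (λ (i : Fin n) → f (toℕ i)) (λ i → g (toℕ i))

∏-const : ∀ n c → ∏ n (λ _ → c) ≡ c ^ n
∏-const zero    c = refl
∏-const (suc n) c = cong (c *_) (∏-const n c)

∏-one : ∀ n {f : ℕ → ℤ} → (∀ k → k < n → f k ≡ 1ℤ) → ∏ n f ≡ 1ℤ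
∏-one n f≡1 = trans (∏-cong n f≡1) (trans (∏-const n 1ℤ) (ℤ.^-zeroˡ n))

∏-split : ∀ m n (f : ℕ → ℤ) → ∏ (m ℕ.+ n) f ≡ ∏ m f * ∏ n (λ k → f (m ℕ.+ k))
∏-split zero    n f = sym (ℤ.*-identityˡ _)
∏-split (suc m) n f = trans (cong (f 0 *_) (∏-split m n (f ∘ suc))) (sym (ℤ.*-assoc (f 0) _ _))

∏-last : ∀ n (f : ℕ → ℤ) → ∏ (suc n) f ≡ ∏ n f * f n
∏-last zero    f = ℤ.*-comm (f 0) 1ℤ
∏-last (suc n) f = trans (cong (f 0 *_) (∏-last n (f ∘ suc))) (sym (ℤ.*-assoc (f 0) _ _))

∏-reverse : ∀ n (f : ℕ → ℤ) → ∏ n f ≡ ∏ n (λ k → f (n ℕ.∸ suc k))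
∏-reverse zero    f = refl
∏-reverse (suc n) f =
  trans (∏-last n f) (trans (ℤ.*-comm _ (f n)) (cong (f n *_) (∏-reverse n f)))

∏-permute : ∀ n (f : ℕ → ℤ) (π π⁻¹ : ℕ → ℕ) →
  (∀ k → k < n → π k < n) → (∀ k → k < n → π⁻¹ k < n) →
  (∀ k → k < n → π⁻¹ (π k) ≡ k) → (∀ k → k < n → π (π⁻¹ k) ≡ k) →
  ∏ n (f ∘ π) ≡ ∏ n f
∏-permute n f π π⁻¹ π< π⁻¹< left right = sym (trans
  (sum-permute (λ (i : Fin n) → f (toℕ i)) (permutation to from to-from from-to))
  (sum-cong-≗ {n} (λ i → cong f (Fin.toℕ-fromℕ< (π< (toℕ i) (Fin.toℕ<n i))))))
  where
  to from : Fin n → Fin n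
  to i = fromℕ< (π< (toℕ i) (Fin.toℕ<n i))
  from i = fromℕ< (π⁻¹< (toℕ i) (Fin.toℕ<n i))
  to-from : ∀ i → to (from i) ≡ i
  to-from i = Fin.toℕ-injective (trans (Fin.toℕ-fromℕ< _)
    (trans (cong π (Fin.toℕ-fromℕ< _)) (right (toℕ i) (Fin.toℕ<n i))))
  from-to : ∀ i → from (to i) ≡ i
  from-to i = Fin.toℕ-injective (trans (Fin.toℕ-fromℕ< _)
    (trans (cong π⁻¹ (Fin.toℕ-fromℕ< _)) (left (toℕ i) (Fin.toℕ<n i))))

-- Signs and least absolute residues

IsSign : ℤ → Set
IsSign z = z ≡ 1ℤ ⊎ z ≡ -1ℤ

isSign-* : IsSign y → IsSign z → IsSign (y * z)
isSign-* (inj₁ refl) (inj₁ refl) = inj₁ refl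
isSign-* (inj₁ refl) (inj₂ refl) = inj₂ refl
isSign-* (inj₂ refl) (inj₁ refl) = inj₂ refl
isSign-* (inj₂ refl) (inj₂ refl) = inj₁ refl

isSign-square : IsSign z → z * z ≡ 1ℤ
isSign-square (inj₁ refl) = refl
isSign-square (inj₂ refl) = refl

-1^-isSign : ∀ n → IsSign (-1ℤ ^ n)
-1^-isSign zero    = inj₁ refl
-1^-isSign (suc n) = isSign-* (inj₂ refl) (-1^-isSign n)

∏-isSign : ∀ n {f : ℕ → ℤ} → (∀ k → IsSign (f k)) → IsSign (∏ n f)
∏-isSign zero    f± = inj₁ refl
∏-isSign (suc n) f± = isSign-* (f± 0) (∏-isSign n (f± ∘ suc))

-- Zero counts as positive, which makes the index 0 harmless in products of signs.
σ : ℤ → ℤ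
σ (+ _)    = 1ℤ
σ -[1+ _ ] = -1ℤ

σ-isSign : ∀ b → IsSign (σ b)
σ-isSign (+ _)    = inj₁ refl
σ-isSign -[1+ _ ] = inj₂ refl

σ-*-∣∣ : ∀ b → b ≡ σ b * + ∣ b ∣
σ-*-∣∣ (+ k)    = sym (ℤ.*-identityˡ (+ k))
σ-*-∣∣ -[1+ k ] = sym (ℤ.-1*i≡-i (+ suc k))

odd : ℕ → ℕ
odd h = suc (2 ℕ.* h)

odd≡ : ∀ h → odd h ≡ suc h ℕ.+ h
odd≡ h = cong (λ t → suc (h ℕ.+ t)) (ℕ.+-identityʳ h)

h<odd : ∀ h → h < odd h
h<odd h = s≤s (ℕ.m≤m+n h _)

-- The least absolute residue modulo `odd h`, lying between `- h` and `h`.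
bal : ℕ → ℤ → ℤ
bal h y with (y %ℕ odd h) ≤? h
... | yes _ = + (y %ℕ odd h)
... | no  _ = + (y %ℕ odd h) - + odd h

bal-≈ : ∀ h y → y ≈ bal h y [ odd h ]
bal-≈ h y with (y %ℕ odd h) ≤? h
... | yes _ = ≈-% y (odd h)
... | no  _ = ≈-trans (≈-% y (odd h)) (quot 1ℤ (lemma (+ (y %ℕ odd h)) (+ odd h)))
  where
  lemma : ∀ r n → r ≡ r - n + 1ℤ * n
  lemma = solve-∀

∣bal∣≤ : ∀ h y → ∣ bal h y ∣ ≤ h
∣bal∣≤ h y with (y %ℕ odd h) ≤? h
... | yes r≤h = r≤h
... | no  r≰h = begin
  ∣ + r - + odd h ∣  ≡⟨ cong ∣_∣ (ℤ.m-n≡m⊖n r (odd h)) ⟩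
  ∣ r ℤ.⊖ odd h ∣    ≡⟨ ℤ.∣⊖∣-≤ (ℕ.<⇒≤ (n%ℕd<d y (odd h))) ⟩
  odd h ℕ.∸ r        ≤⟨ ℕ.m≤n+o⇒m∸n≤o (odd h) r (begin
    odd h               ≡⟨ odd≡ h ⟩
    suc h ℕ.+ h         ≤⟨ ℕ.+-monoˡ-≤ h (ℕ.≰⇒> r≰h) ⟩
    r ℕ.+ h             ∎) ⟩
  h                  ∎
  where
  open ℕ.≤-Reasoning
  r = y %ℕ odd h

-- The difference is at most 2h in absolute value, one less than the modulus.
≈⇒≡-small : ∀ h → ∣ a ∣ ≤ h → ∣ b ∣ ≤ h → a ≈ b [ odd h ] → a ≡ b
≈⇒≡-small {a} {b} h a≤h b≤h = ≈⇒≡ (s≤s (begin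
  ∣ a - b ∣            ≤⟨ ℤ.∣i-j∣≤∣i∣+∣j∣ a b ⟩
  ∣ a ∣ ℕ.+ ∣ b ∣      ≤⟨ ℕ.+-mono-≤ a≤h b≤h ⟩
  h ℕ.+ h              ≡⟨ cong (h ℕ.+_) (sym (ℕ.+-identityʳ h)) ⟩
  2 ℕ.* h              ∎))
  where open ℕ.≤-Reasoning

bal-unique : ∀ h → ∣ b ∣ ≤ h → y ≈ b [ odd h ] → bal h y ≡ b
bal-unique {y = y} h b≤h y≈b =
  ≈⇒≡-small h (∣bal∣≤ h y) b≤h (≈-trans (≈-sym (bal-≈ h y)) y≈b)

ε : ℕ → ℤ → ℤ
ε h y = σ (bal h y)

ε-isSign : ∀ h y → IsSign (ε h y)
ε-isSign h y = σ-isSign (bal h y)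

ε-pos : ∀ h → k ≤ h → y ≈ + k [ odd h ] → ε h y ≡ 1ℤ
ε-pos h k≤h y≈k = cong σ (bal-unique h k≤h y≈k)

ε-neg : ∀ h → suc k ≤ h → y ≈ -[1+ k ] [ odd h ] → ε h y ≡ -1ℤ
ε-neg h k<h y≈-k = cong σ (bal-unique h k<h y≈-k)

ε-cong : ∀ h → y ≈ z [ odd h ] → ε h y ≡ ε h z
ε-cong {y} {z} h y≈z = cong σ (bal-unique h (∣bal∣≤ h z) (≈-trans y≈z (bal-≈ h z)))

-- The class of 0 is the exception, because `σ` gives it the sign 1.
ε-odd : ∀ h y → ¬ y ≈ 0ℤ [ odd h ] → ε h (- y) ≡ - ε h y
ε-odd h y y≉0 = trans
  (cong σ (bal-unique h (subst (_≤ h) (sym (ℤ.∣-i∣≡∣i∣ (bal h y))) (∣bal∣≤ h y)) (-‿cong (bal-≈ h y))))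
  (go (bal h y) (λ e → y≉0 (subst (y ≈_[ odd h ]) e (bal-≈ h y))))
  where
  go : ∀ b → b ≢ 0ℤ → σ (- b) ≡ - σ b
  go (+ zero)  b≢0 = ⊥-elim (b≢0 refl)
  go (+ suc k) b≢0 = refl
  go -[1+ k ]  b≢0 = refl

μ : ℕ → ℤ → ℕ
μ h y = ∣ bal h y ∣

ε-*-μ : ∀ h y → y ≈ ε h y * + μ h y [ odd h ]
ε-*-μ h y = ≈-trans (bal-≈ h y) (≈-reflexive (σ-*-∣∣ (bal h y)))

μ-≈ : ∀ h → k ≤ h → y ≈ + k [ odd h ] ⊎ y ≈ - + k [ odd h ] → μ h y ≡ k
μ-≈ h k≤h (inj₁ p) = cong ∣_∣ (bal-unique h k≤h p)
μ-≈ {k} h k≤h (inj₂ p) = trans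
  (cong ∣_∣ (bal-unique h (subst (_≤ h) (sym (ℤ.∣-i∣≡∣i∣ (+ k))) k≤h) p))
  (ℤ.∣-i∣≡∣i∣ (+ k))

small≉0 : ∀ h → suc k ≤ h → ¬ + suc k ≈ 0ℤ [ odd h ]
small≉0 h k<h p with () ← ≈⇒≡-small h k<h z≤n p

invertible-*≉0 : Invertible n a → ¬ b ≈ 0ℤ [ n ] → ¬ a * b ≈ 0ℤ [ n ]
invertible-*≉0 {a = a} inv b≉0 p =
  b≉0 (invertible-cancel inv (≈-trans p (≈-reflexive (sym (ℤ.*-zeroʳ a)))))

-- Write y as its sign times `μ h y` and pull the sign out of `a * y`. When that sign is -1, `ε-odd`
-- applies since `a` is a unit and y is nonzero.
ε-* : ∀ h y → Invertible (odd h) a → ε h (a * y) ≡ ε h (a * + μ h y) * ε h y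
ε-* {a} h y inv = go (bal h y) (bal-≈ h y) (∣bal∣≤ h y)
  where
  go : ∀ β → y ≈ β [ odd h ] → ∣ β ∣ ≤ h → ε h (a * y) ≡ ε h (a * + ∣ β ∣) * σ β
  go (+ j)    y≈β β≤h = trans (ε-cong h (*-congˡ a y≈β)) (sym (ℤ.*-identityʳ _))
  go -[1+ j ] y≈β β≤h = begin
    ε h (a * y)             ≡⟨ ε-cong h (≈-trans (*-congˡ a y≈β) (≈-reflexive (sym (ℤ.neg-distribʳ-* a (+ suc j))))) ⟩
    ε h (- (a * + suc j))   ≡⟨ ε-odd h _ (invertible-*≉0 inv (small≉0 h β≤h)) ⟩
    - ε h (a * + suc j)     ≡⟨ lemma (ε h (a * + suc j)) ⟩
    ε h (a * + suc j) * -1ℤ ∎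
    where
    open ≡-Reasoning
    lemma : ∀ t → - t ≡ t * -1ℤ
    lemma = solve-∀

-- The sign product `G` and its multiplicativity in a

-- The index 0 contributes 1 and is included so that k ↦ `μ h (a * + k)` permutes an initial segment
-- of ℕ.
G : ℕ → ℤ → ℤ
G h a = ∏ (suc h) (λ k → ε h (a * + k))

G-isSign : ∀ h a → IsSign (G h a)
G-isSign h a = ∏-isSign (suc h) (λ k → ε-isSign h (a * + k))

G-cong : ∀ h → a ≈ b [ odd h ] → G h a ≡ G h b
G-cong h a≈b = ∏-cong (suc h) (λ k _ → ε-cong h (*-congʳ (+ k) a≈b))

-- The inverse permutation is the same map for `a⁻¹`: dropping the sign of ak changes its product
-- with `a⁻¹` at most to -k, and `μ` ignores that sign.
∏-permute-μ : ∀ h a → Invertible (odd h) a → (f : ℕ → ℤ) →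
  ∏ (suc h) (λ k → f (μ h (a * + k))) ≡ ∏ (suc h) f
∏-permute-μ h a (a⁻¹ , a⁻¹a≈1) f = ∏-permute (suc h) f
  (λ k → μ h (a * + k)) (λ k → μ h (a⁻¹ * + k))
  (λ k _ → s≤s (∣bal∣≤ h (a * + k))) (λ k _ → s≤s (∣bal∣≤ h (a⁻¹ * + k)))
  (λ k k<1+h → inverse a a⁻¹ k (ℕ.≤-pred k<1+h) a⁻¹a≈1)
  (λ k k<1+h → inverse a⁻¹ a k (ℕ.≤-pred k<1+h)
    (≈-trans (≈-reflexive (ℤ.*-comm a a⁻¹)) a⁻¹a≈1))
  where
  inverse : ∀ a a⁻¹ k → k ≤ h → a⁻¹ * a ≈ 1ℤ [ odd h ] →
    μ h (a⁻¹ * + μ h (a * + k)) ≡ k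
  inverse a a⁻¹ k k≤h a⁻¹a≈1 = μ-≈ h k≤h (go (bal h (a * + k)) (bal-≈ h (a * + k)))
    where
    unit : a⁻¹ * (a * + k) ≈ + k [ odd h ]
    unit = ≈-trans (≈-reflexive (sym (ℤ.*-assoc a⁻¹ a (+ k))))
      (≈-trans (*-congʳ (+ k) a⁻¹a≈1) (≈-reflexive (ℤ.*-identityˡ (+ k))))
    go : ∀ β → a * + k ≈ β [ odd h ] →
      a⁻¹ * + ∣ β ∣ ≈ + k [ odd h ] ⊎ a⁻¹ * + ∣ β ∣ ≈ - + k [ odd h ]
    go (+ j)    p = inj₁ (≈-trans (*-congˡ a⁻¹ (≈-sym p)) unit)
    go -[1+ j ] p = inj₂ (≈-trans (*-congˡ a⁻¹ (-‿cong (≈-sym p)))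
      (≈-trans (≈-reflexive (sym (ℤ.neg-distribʳ-* a⁻¹ (a * + k)))) (-‿cong unit)))

-- `ε-*` is a cocycle identity; taking the product over k and reindexing by `μ` removes its twist.
G-* : ∀ h → Invertible (odd h) a → Invertible (odd h) b → G h (a * b) ≡ G h a * G h b
G-* {a} {b} h a-inv b-inv = begin
  ∏ (suc h) (λ k → ε h (a * b * + k))
    ≡⟨ ∏-cong (suc h) (λ k _ → trans (cong (ε h) (ℤ.*-assoc a b (+ k))) (ε-* h (b * + k) a-inv)) ⟩
  ∏ (suc h) (λ k → ε h (a * + μ h (b * + k)) * ε h (b * + k))
    ≡⟨ ∏-distrib-* (suc h) (λ k → ε h (a * + μ h (b * + k))) (λ k → ε h (b * + k)) ⟩
  ∏ (suc h) (λ k → ε h (a * + μ h (b * + k))) * G h b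
    ≡⟨ cong (_* G h b) (∏-permute-μ h b b-inv (λ k → ε h (a * + k))) ⟩
  G h a * G h b ∎
  where open ≡-Reasoning

G-tail : ∀ h a → G h a ≡ ∏ h (λ k → ε h (a * + suc k))
G-tail h a = trans
  (cong (_* ∏ h (λ k → ε h (a * + suc k))) (ε-pos h z≤n (≈-reflexive (ℤ.*-zeroʳ a))))
  (ℤ.*-identityˡ _)

G-1 : ∀ h → G h 1ℤ ≡ 1ℤ
G-1 h = ∏-one (suc h) (λ k k<1+h → ε-pos h (ℕ.≤-pred k<1+h) (≈-reflexive (ℤ.*-identityˡ (+ k))))

G-[-1] : ∀ h → G h -1ℤ ≡ -1ℤ ^ h
G-[-1] h = trans (G-tail h -1ℤ) (trans
  (∏-cong h (λ k k<h → ε-neg h k<h (≈-reflexive (ℤ.-1*i≡-i (+ suc k)))))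
  (∏-const h -1ℤ))

-- Multiplicativity of `G` in the modulus

∏-comm : ∀ m n (f : ℕ → ℕ → ℤ) → ∏ m (λ i → ∏ n (f i)) ≡ ∏ n (λ j → ∏ m (λ i → f i j))
∏-comm m n f = ∑-comm (λ (i : Fin m) (j : Fin n) → f (toℕ i) (toℕ j))

∏-concat : ∀ m n (f : ℕ → ℤ) → ∏ (m ℕ.* n) f ≡ ∏ m (λ j → ∏ n (λ i → f (j ℕ.* n ℕ.+ i)))
∏-concat zero    n f = refl
∏-concat (suc m) n f = trans (∏-split n (m ℕ.* n) f) (cong (∏ n f *_)
  (trans (∏-concat m n (λ i → f (n ℕ.+ i)))
    (∏-cong m (λ j _ → ∏-cong n (λ i _ → cong f (sym (ℕ.+-assoc n (j ℕ.* n) i)))))))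

-- The upper half is taken in descending order, so that its k-th index is `odd h` minus `suc k`,
-- that is, minus `suc k` modulo `odd h`.
∏-odd : ∀ h (f : ℕ → ℤ) →
  ∏ (odd h) f ≡ ∏ (suc h) f * ∏ h (λ k → f (suc h ℕ.+ (h ℕ.∸ suc k)))
∏-odd h f = begin
  ∏ (odd h) f                                               ≡⟨ cong (λ n → ∏ n f) (odd≡ h) ⟩
  ∏ (suc h ℕ.+ h) f                                         ≡⟨ ∏-split (suc h) h f ⟩
  ∏ (suc h) f * ∏ h (λ k → f (suc h ℕ.+ k))                 ≡⟨ cong (∏ (suc h) f *_) (∏-reverse h (λ k → f (suc h ℕ.+ k))) ⟩
  ∏ (suc h) f * ∏ h (λ k → f (suc h ℕ.+ (h ℕ.∸ suc k)))     ∎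
  where open ≡-Reasoning

-- Meant for blocks whose middle is a multiple of the modulus: the indices paired here are then
-- negatives of each other modulo it.
∏-centred : ∀ h (f : ℕ → ℤ) →
  ∏ (odd h) f ≡ f h * ∏ h (λ k → f (h ℕ.∸ suc k) * f (suc h ℕ.+ k))
∏-centred h f = begin
  ∏ (odd h) f                                                   ≡⟨ cong (λ n → ∏ n f) (odd≡ h) ⟩
  ∏ (suc h ℕ.+ h) f                                             ≡⟨ ∏-split (suc h) h f ⟩
  ∏ (suc h) f * R                                               ≡⟨ cong (_* R) (∏-last h f) ⟩
  ∏ h f * f h * R                                               ≡⟨ cong (λ t → t * f h * R) (∏-reverse h f) ⟩
  ∏ h (λ k → f (h ℕ.∸ suc k)) * f h * R                         ≡⟨ lemma (∏ h (λ k → f (h ℕ.∸ suc k))) (f h) R ⟩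
  f h * (∏ h (λ k → f (h ℕ.∸ suc k)) * R)
    ≡⟨ cong (f h *_) (sym (∏-distrib-* h (λ k → f (h ℕ.∸ suc k)) (λ k → f (suc h ℕ.+ k)))) ⟩
  f h * ∏ h (λ k → f (h ℕ.∸ suc k) * f (suc h ℕ.+ k))           ∎
  where
  open ≡-Reasoning
  R = ∏ h (λ k → f (suc h ℕ.+ k))
  lemma : ∀ x y z → x * y * z ≡ y * (x * z)
  lemma = solve-∀

%ℕ-unique : ∀ n .{{_ : NonZero n}} → k < n → y ≈ + k [ n ] → y %ℕ n ≡ k
%ℕ-unique {k} {y} n k<n y≈k = ℤ.+-injective (≈⇒≡ bound (≈-trans (≈-sym (≈-% y n)) y≈k))
  where
  r = y %ℕ n
  bound : ∣ + r - + k ∣ < n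
  bound = ℕ.≤-<-trans (subst (λ t → ∣ t ∣ ≤ r ℕ.⊔ k) (sym (ℤ.m-n≡m⊖n r k)) (ℤ.∣m⊝n∣≤m⊔n r k))
    (ℕ.⊔-pres-<m (n%ℕd<d y n) k<n)

-- An affine map with unit slope permutes the residues modulo `n`.
∏-affine : ∀ n .{{_ : NonZero n}} (f : ℤ → ℤ) → (∀ {y z} → y ≈ z [ n ] → f y ≡ f z) →
  Invertible n a → ∀ q → ∏ n (λ i → f (q + a * + i)) ≡ ∏ n (λ i → f (+ i))
∏-affine {a} n f f-cong (a⁻¹ , a⁻¹a≈1) q = trans
  (∏-cong n (λ i _ → f-cong (≈-% (q + a * + i) n)))
  (∏-permute n (f ∘ +_) (λ i → (q + a * + i) %ℕ n) (λ i → (a⁻¹ * (+ i - q)) %ℕ n)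
    (λ i _ → n%ℕd<d (q + a * + i) n) (λ i _ → n%ℕd<d (a⁻¹ * (+ i - q)) n)
    (λ i i<n → %ℕ-unique n i<n (≈-trans
      (*-congˡ a⁻¹ (+-cong (≈-sym (≈-% (q + a * + i) n)) (≈-refl { - q})))
      (≈-trans (≈-reflexive (lemma₁ a a⁻¹ q (+ i))) (unit (+ i)))))
    (λ i i<n → %ℕ-unique n i<n (≈-trans
      (+-cong (≈-refl {q}) (*-congˡ a (≈-sym (≈-% (a⁻¹ * (+ i - q)) n))))
      (≈-trans (≈-reflexive (lemma₂ a a⁻¹ q (+ i)))
        (≈-trans (+-cong (≈-refl {q}) (unit (+ i - q))) (≈-reflexive (lemma₃ q (+ i))))))))
  where
  unit : ∀ z → a⁻¹ * a * z ≈ z [ n ]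
  unit z = ≈-trans (*-congʳ z a⁻¹a≈1) (≈-reflexive (ℤ.*-identityˡ z))
  lemma₁ : ∀ a a⁻¹ q i → a⁻¹ * (q + a * i - q) ≡ a⁻¹ * a * i
  lemma₁ = solve-∀
  lemma₂ : ∀ a a⁻¹ q i → q + a * (a⁻¹ * (i - q)) ≡ q + a⁻¹ * a * (i - q)
  lemma₂ = solve-∀
  lemma₃ : ∀ q i → q + (i - q) ≡ i
  lemma₃ = solve-∀

+-positive : ∀ β → ∣ β ∣ < k → ∃ λ l → β + + k ≡ + suc l
+-positive {suc k} (+ j)    _ = j ℕ.+ k , cong +_ (ℕ.+-suc j k)
+-positive {suc k} -[1+ j ] (s≤s j<k) = k ℕ.∸ suc j , (begin
  suc k ℤ.⊖ suc j       ≡⟨ ℤ.⊖-≥ (ℕ.m≤n⇒m≤1+n j<k) ⟩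
  + (suc k ℕ.∸ suc j)   ≡⟨ cong +_ (ℕ.+-∸-assoc 1 j<k) ⟩
  + suc (k ℕ.∸ suc j)   ∎)
  where open ≡-Reasoning

σ-+ : ∀ β → ∣ β ∣ < k → σ (β + + k) ≡ 1ℤ
σ-+ β β<k with _ , e ← +-positive β β<k rewrite e = refl

σ-- : ∀ β → ∣ β ∣ < k → σ (β - + k) ≡ -1ℤ
σ-- {k} β β<k with l , e ← +-positive (- β) (subst (_< k) (sym (ℤ.∣-i∣≡∣i∣ β)) β<k) =
  cong σ {y = -[1+ l ]} (trans (lemma β (+ k)) (cong (-_) e))
  where
  lemma : ∀ β k → β - k ≡ - (- β + k)
  lemma = solve-∀

module _ (u v : ℕ) where

  private
    M = odd u
    N = odd v

  -- Written so that `suc half-*` unfolds to `suc u + v * odd u`: the range {0, ..., u} followed by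
  -- v blocks of length M.
  half-* : ℕ
  half-* = u ℕ.+ v ℕ.* odd u

  odd-half-* : odd half-* ≡ odd u ℕ.* odd v
  odd-half-* = lemma u v
    where
    lemma : ∀ u v → suc (2 ℕ.* (u ℕ.+ v ℕ.* suc (2 ℕ.* u))) ≡ suc (2 ℕ.* u) ℕ.* suc (2 ℕ.* v)
    lemma = ℕ-Ring.solve-∀

  private
    w = half-*

    to : y ≈ z [ M ℕ.* N ] → y ≈ z [ odd w ]
    to {y} {z} = subst (y ≈ z [_]) (sym odd-half-*)

    from : y ≈ z [ odd w ] → y ≈ z [ M ℕ.* N ]
    from {y} {z} = subst (y ≈ z [_]) odd-half-*

    bound : ∀ β j → ∣ β ∣ ≤ u → j ≤ v → ∣ β ∣ ℕ.+ M ℕ.* j ≤ w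
    bound β j β≤u j≤v = ℕ.+-mono-≤ β≤u (subst (_≤ v ℕ.* M) (ℕ.*-comm j M) (ℕ.*-monoˡ-≤ M j≤v))

    β<M* : ∀ β j → ∣ β ∣ ≤ u → ∣ β ∣ < M ℕ.* suc j
    β<M* β j β≤u = ℕ.<-≤-trans (ℕ.≤-<-trans β≤u (h<odd u)) (ℕ.m≤m*n M (suc j))

  -- M times a least absolute residue modulo N has size at most Mv ≤ w, so it is already the least
  -- absolute residue modulo MN.
  ε-scale : ∀ y → ε w (+ M * y) ≡ ε v y
  ε-scale y = go (bal v y) (bal-≈ v y) (∣bal∣≤ v y)
    where
    go : ∀ β → y ≈ β [ N ] → ∣ β ∣ ≤ v → ε w (+ M * y) ≡ σ β
    go β y≈β β≤v = trans
      (cong σ (bal-unique w (subst (_≤ w) (sym (ℤ.abs-* (+ M) β)) (bound 0ℤ ∣ β ∣ z≤n β≤v))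
        (to (≈-scale M y≈β))))
      (σ-scale β)
      where
      σ-scale : ∀ β → σ (+ M * β) ≡ σ β
      σ-scale (+ j)    = cong σ (sym (ℤ.pos-* M j))
      σ-scale -[1+ j ] = refl

  -- The lift i = 0 has the sign of β, the next v lifts are positive, and the last v reduce to β -
  -- M(j + 1) with j < v, which are negative.
  ∏-ε-lifts : ∀ β → ∣ β ∣ ≤ u → ∏ N (λ i → ε w (β + + M * + i)) ≡ -1ℤ ^ v * σ β
  ∏-ε-lifts β β≤u = begin
    ∏ N f                                              ≡⟨ ∏-odd v f ⟩
    f 0 * ∏ v (f ∘ suc) * ∏ v (λ j → f (suc v ℕ.+ (v ℕ.∸ suc j)))
      ≡⟨ cong₂ _*_ (cong₂ _*_ f-zero (∏-one v f-suc)) (trans (∏-cong v f-upper) (∏-const v -1ℤ)) ⟩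
    σ β * 1ℤ * -1ℤ ^ v                                 ≡⟨ lemma (σ β) (-1ℤ ^ v) ⟩
    -1ℤ ^ v * σ β ∎
    where
    open ≡-Reasoning
    f : ℕ → ℤ
    f i = ε w (β + + M * + i)
    lemma : ∀ x y → x * 1ℤ * y ≡ y * x
    lemma = solve-∀
    f-zero : f 0 ≡ σ β
    f-zero = cong σ (bal-unique w (ℕ.≤-trans β≤u (ℕ.m≤m+n u _))
      (≈-reflexive (trans (cong (λ t → β + t) (ℤ.*-zeroʳ (+ M))) (ℤ.+-identityʳ β))))
    f-suc : ∀ j → j < v → f (suc j) ≡ 1ℤ
    f-suc j j<v = trans
      (cong σ (bal-unique w
        (ℕ.≤-trans (ℤ.∣i+j∣≤∣i∣+∣j∣ β (+ (M ℕ.* suc j))) (bound β (suc j) β≤u j<v))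
        (≈-reflexive (cong (λ t → β + t) (sym (ℤ.pos-* M (suc j)))))))
      (σ-+ β (β<M* β j β≤u))
    f-upper : ∀ j → j < v → f (suc v ℕ.+ (v ℕ.∸ suc j)) ≡ -1ℤ
    f-upper j j<v = trans
      (cong σ (bal-unique w
        (ℕ.≤-trans (ℤ.∣i-j∣≤∣i∣+∣j∣ β (+ (M ℕ.* suc j))) (bound β (suc j) β≤u j<v))
        (to (quot 1ℤ shift))))
      (σ-- β (β<M* β j β≤u))
      where
      i = suc v ℕ.+ (v ℕ.∸ suc j)
      i+1+j : i ℕ.+ suc j ≡ N
      i+1+j = trans (ℕ.+-assoc (suc v) (v ℕ.∸ suc j) (suc j))
        (trans (cong (suc v ℕ.+_) (ℕ.m∸n+n≡m j<v)) (sym (odd≡ v)))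
      shift : β + + M * + i ≡ β - + (M ℕ.* suc j) + 1ℤ * + (M ℕ.* N)
      shift = trans (identity β (+ M) (+ i) (+ suc j))
        (cong₂ (λ s t → β - s + 1ℤ * t) (sym (ℤ.pos-* M (suc j)))
          (trans (cong (λ t → + M * + t) i+1+j) (sym (ℤ.pos-* M N))))
        where
        identity : ∀ β m i j → β + m * i ≡ β - m * j + 1ℤ * (m * (i + j))
        identity = solve-∀

  module _ {a : ℤ} (a-inv : Invertible (odd w) a) where

    private
      a-inv-M : Invertible M a
      a-inv-M = proj₁ a-inv , ≈-factorˡ M (from (proj₂ a-inv))

      a-inv-N : Invertible N a
      a-inv-N = proj₁ a-inv , ≈-factorʳ M (from (proj₂ a-inv))

    -- Modulo MN the progression is again the set of lifts of y modulo M, since `a` is a unit modulo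
    -- N; `∏-affine` removes both the step `a` and the quotient of y by M.
    ∏-ε-progression : ∀ y → ∏ N (λ i → ε w (y + a * (+ M * + i))) ≡ -1ℤ ^ v * ε u y
    ∏-ε-progression y = go (bal-≈ u y)
      where
      open ≡-Reasoning
      β = bal u y
      lemma : ∀ β q m a i → β + q * m + a * (m * i) ≡ β + m * (q + a * i)
      lemma = solve-∀
      go : y ≈ β [ M ] → ∏ N (λ i → ε w (y + a * (+ M * + i))) ≡ -1ℤ ^ v * ε u y
      go (quot q eq) = begin
        ∏ N (λ i → ε w (y + a * (+ M * + i)))
          ≡⟨ ∏-cong N (λ i _ → cong (ε w) (trans (cong (_+ a * (+ M * + i)) eq) (lemma β q (+ M) a (+ i)))) ⟩
        ∏ N (λ i → ε w (β + + M * (q + a * + i)))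
          ≡⟨ ∏-affine N (λ z → ε w (β + + M * z))
               (λ p → ε-cong w (+-cong (≈-refl {β}) (to (≈-scale M p)))) a-inv-N q ⟩
        ∏ N (λ i → ε w (β + + M * + i))
          ≡⟨ ∏-ε-lifts β (∣bal∣≤ u y) ⟩
        -1ℤ ^ v * ε u y ∎

    private
      g : ℕ → ℤ
      g k = ε w (a * + k)

    -- The contribution to G w a of the elements ≡ ± (1 + s) modulo M of the half system {1, …, w}.
    ∏-class : ∀ s → s < u →
      g (suc s) * ∏ v (λ j → g (suc u ℕ.+ (j ℕ.* M ℕ.+ (u ℕ.∸ suc s)))
                           * g (suc u ℕ.+ (j ℕ.* M ℕ.+ (suc u ℕ.+ s))))
        ≡ ε u (a * + suc s)
    ∏-class s s<u = begin
      g t * ∏ v (λ j → g (below j) * g (above j))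
        ≡⟨ cong₂ (λ x y → x * y) f-zero (∏-cong v (λ j j<v →
             trans (cong₂ _*_ (f-below j j<v) (f-above j)) (regroup (f (top j)) (f (suc j))))) ⟩
      f 0 * ∏ v (λ j → -1ℤ * (f (suc j) * f (top j)))
        ≡⟨ cong (f 0 *_) (trans (∏-distrib-* v (λ _ → -1ℤ) (λ j → f (suc j) * f (top j)))
             (cong₂ _*_ (∏-const v -1ℤ) (∏-distrib-* v (f ∘ suc) (f ∘ top)))) ⟩
      f 0 * (-1ℤ ^ v * (∏ v (f ∘ suc) * ∏ v (f ∘ top)))
        ≡⟨ regroup′ (f 0) (-1ℤ ^ v) _ _ ⟩
      -1ℤ ^ v * (∏ (suc v) f * ∏ v (f ∘ top))
        ≡⟨ cong (-1ℤ ^ v *_) (sym (∏-odd v f)) ⟩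
      -- The (-1)^v left by the v negated terms meets the one from `∏-ε-progression`.
      -1ℤ ^ v * ∏ N f
        ≡⟨ cong (-1ℤ ^ v *_) (∏-ε-progression (a * + t)) ⟩
      -1ℤ ^ v * (-1ℤ ^ v * ε u (a * + t))
        ≡⟨ sym (ℤ.*-assoc (-1ℤ ^ v) (-1ℤ ^ v) _) ⟩
      -1ℤ ^ v * -1ℤ ^ v * ε u (a * + t)
        ≡⟨ cong (_* ε u (a * + t)) (isSign-square (-1^-isSign v)) ⟩
      1ℤ * ε u (a * + t)
        ≡⟨ ℤ.*-identityˡ _ ⟩
      ε u (a * + t) ∎
      where
      open ≡-Reasoning
      t = suc s
      -- `above j` is t + M(j + 1). `below j` is M(j + 1) - t, which modulo MN is the negative of t
      -- + M `top j` because `top j` = N - (j + 1). So t, the `above j` and the negated `below j`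
      -- are all N lifts of t.
      below above top : ℕ → ℕ
      below j = suc u ℕ.+ (j ℕ.* M ℕ.+ (u ℕ.∸ suc s))
      above j = suc u ℕ.+ (j ℕ.* M ℕ.+ (suc u ℕ.+ s))
      top j = suc v ℕ.+ (v ℕ.∸ suc j)
      f : ℕ → ℤ
      f i = ε w (a * + t + a * (+ M * + i))
      regroup : ∀ x y → - x * y ≡ -1ℤ * (y * x)
      regroup = solve-∀
      regroup′ : ∀ x e p q → x * (e * (p * q)) ≡ e * (x * p * q)
      regroup′ = solve-∀
      f-zero : g t ≡ f 0
      f-zero = cong (ε w) (lemma a (+ t) (+ M))
        where
        lemma : ∀ a t m → a * t ≡ a * t + a * (m * 0ℤ)
        lemma = solve-∀
      below+t : ∀ j → below j ℕ.+ t ≡ suc j ℕ.* M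
      below+t j = trans (lemma₁ u (j ℕ.* M) (u ℕ.∸ suc s) t)
        (trans (cong (λ x → suc u ℕ.+ (j ℕ.* M ℕ.+ x)) (ℕ.m∸n+n≡m s<u)) (lemma₂ u (j ℕ.* M)))
        where
        lemma₁ : ∀ u x y t → suc u ℕ.+ (x ℕ.+ y) ℕ.+ t ≡ suc u ℕ.+ (x ℕ.+ (y ℕ.+ t))
        lemma₁ = ℕ-Ring.solve-∀
        lemma₂ : ∀ u x → suc u ℕ.+ (x ℕ.+ u) ≡ suc (2 ℕ.* u) ℕ.+ x
        lemma₂ = ℕ-Ring.solve-∀
      top+1+j : ∀ j → j < v → top j ℕ.+ suc j ≡ N
      top+1+j j j<v = trans (ℕ.+-assoc (suc v) (v ℕ.∸ suc j) (suc j))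
        (trans (cong (suc v ℕ.+_) (ℕ.m∸n+n≡m j<v)) (sym (odd≡ v)))
      f-above : ∀ j → g (above j) ≡ f (suc j)
      f-above j = cong (ε w) (trans (cong (λ x → a * + x) (lemma₁ u (j ℕ.* M) s))
        (trans (cong (λ x → a * x) (cong (λ x → + t + x) (ℤ.pos-* (suc j) M))) (lemma₂ a (+ t) (+ suc j) (+ M))))
        where
        lemma₁ : ∀ u x s → suc u ℕ.+ (x ℕ.+ (suc u ℕ.+ s)) ≡ suc s ℕ.+ (suc (2 ℕ.* u) ℕ.+ x)
        lemma₁ = ℕ-Ring.solve-∀
        lemma₂ : ∀ a t j m → a * (t + j * m) ≡ a * t + a * (m * j)
        lemma₂ = solve-∀
      f-below : ∀ j → j < v → g (below j) ≡ - f (top j)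
      f-below j j<v = trans (ε-cong {z = - r} w (to (quot a shift))) (ε-odd w r r≉0)
        where
        r = a * + t + a * (+ M * + top j)
        -- Modulo M, r is at with 1 ≤ t ≤ u.
        r≉0 : ¬ r ≈ 0ℤ [ odd w ]
        r≉0 p = invertible-*≉0 a-inv-M (small≉0 u s<u)
          (≈-trans (≈-sym (≈-trans (≈-reflexive (lemma a (+ t) (+ M) (+ top j))) (≈-multiple (a * + top j))))
            (≈-factorˡ M (from p)))
          where
          lemma : ∀ a t m i → a * t + a * (m * i) ≡ a * t + a * i * m
          lemma = solve-∀
        shift : a * + below j ≡ - r + a * + (M ℕ.* N)
        shift = begin
          a * + below j
            ≡⟨ lemma₁ a (+ below j) (+ t) ⟩
          a * + (below j ℕ.+ t) - a * + t
            ≡⟨ cong (λ x → a * x - a * + t) (trans (cong +_ (below+t j)) (ℤ.pos-* (suc j) M)) ⟩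
          a * (+ suc j * + M) - a * + t
            ≡⟨ lemma₂ a (+ suc j) (+ M) (+ t) (+ top j) ⟩
          - r + a * (+ M * + (top j ℕ.+ suc j))
            ≡⟨ cong (λ x → - r + a * x) (trans (cong (λ x → + M * + x) (top+1+j j j<v)) (sym (ℤ.pos-* M N))) ⟩
          - r + a * + (M ℕ.* N) ∎
          where
          lemma₁ : ∀ a b t → a * b ≡ a * (b + t) - a * t
          lemma₁ = solve-∀
          lemma₂ : ∀ a j m t i → a * (j * m) - a * t ≡ - (a * t + a * (m * i)) + a * (m * (i + j))
          lemma₂ = solve-∀

    -- Each block is centred at a multiple of M. The centres together with 0 give the factor for N;
    -- the remaining indices, grouped by their class ± t modulo M, give the factor for M.
    G-modulus-* : G w a ≡ G u a * G v a
    G-modulus-* = begin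
      ∏ (suc u ℕ.+ v ℕ.* M) g
        ≡⟨ ∏-split (suc u) (v ℕ.* M) g ⟩
      ∏ (suc u) g * ∏ (v ℕ.* M) (λ i → g (suc u ℕ.+ i))
        ≡⟨ cong (∏ (suc u) g *_) (∏-concat v M (λ i → g (suc u ℕ.+ i))) ⟩
      ∏ (suc u) g * ∏ v (λ j → ∏ M (λ i → g (suc u ℕ.+ (j ℕ.* M ℕ.+ i))))
        ≡⟨ cong (∏ (suc u) g *_) (trans (∏-cong v (λ j _ → ∏-centred u (λ i → g (suc u ℕ.+ (j ℕ.* M ℕ.+ i)))))
             (trans (∏-distrib-* v centre (λ j → ∏ u (pair j))) (cong (∏ v centre *_) (∏-comm v u pair)))) ⟩
      g 0 * ∏ u (g ∘ suc) * (∏ v centre * ∏ u (λ s → ∏ v (λ j → pair j s)))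
        ≡⟨ regroup (g 0) _ _ _ ⟩
      ∏ u (g ∘ suc) * ∏ u (λ s → ∏ v (λ j → pair j s)) * (g 0 * ∏ v centre)
        ≡⟨ cong₂ _*_ units multiples ⟩
      G u a * G v a ∎
      where
      open ≡-Reasoning
      centre : ℕ → ℤ
      centre j = g (suc u ℕ.+ (j ℕ.* M ℕ.+ u))
      pair : ℕ → ℕ → ℤ
      pair j s = g (suc u ℕ.+ (j ℕ.* M ℕ.+ (u ℕ.∸ suc s)))
               * g (suc u ℕ.+ (j ℕ.* M ℕ.+ (suc u ℕ.+ s)))
      regroup : ∀ x y z t → x * y * (z * t) ≡ y * t * (x * z)
      regroup = solve-∀
      units : ∏ u (g ∘ suc) * ∏ u (λ s → ∏ v (λ j → pair j s)) ≡ G u a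
      units = trans (sym (∏-distrib-* u (g ∘ suc) (λ s → ∏ v (λ j → pair j s))))
        (trans (∏-cong u ∏-class) (sym (G-tail u a)))
      multiples : g 0 * ∏ v centre ≡ G v a
      -- `centre j` sits at (j + 1)M, so 0 and the centres are M times the range of `G v a`.
      multiples = ∏-cong (suc v) {λ { zero → g 0 ; (suc j) → centre j }} {λ k → ε v (a * + k)}
        (λ { zero _ → trans (cong (ε w) (lemma₀ a (+ M))) (ε-scale (a * + 0))
           ; (suc j) _ → trans (cong (λ x → ε w (a * x)) (trans (cong +_ (lemma₁ u (j ℕ.* M))) (ℤ.pos-* (suc j) M)))
               (trans (cong (ε w) (lemma₂ a (+ suc j) (+ M))) (ε-scale (a * + suc j))) })
        where
        lemma₀ : ∀ a m → a * 0ℤ ≡ m * (a * 0ℤ)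
        lemma₀ = solve-∀
        lemma₁ : ∀ u x → suc u ℕ.+ (x ℕ.+ u) ≡ suc (2 ℕ.* u) ℕ.+ x
        lemma₁ = ℕ-Ring.solve-∀
        lemma₂ : ∀ a j m → a * (j * m) ≡ m * (a * j)
        lemma₂ = solve-∀

-- Roots of monic polynomials modulo a prime

≈0⇒∣ : a ≈ 0ℤ [ n ] → n ℕ∣.∣ ∣ a ∣
≈0⇒∣ {n = n} (quot q refl) = ℕ∣.divides ∣ q ∣
  (trans (cong ∣_∣ (ℤ.+-identityˡ (q * + n))) (ℤ.abs-* q (+ n)))

∣⇒≈0 : n ℕ∣.∣ ∣ a ∣ → a ≈ 0ℤ [ n ]
∣⇒≈0 {n} {a} n∣a with divides q eq ← ∣ᵤ⇒∣ {+ n} {a} n∣a = quot q (trans eq (sym (ℤ.+-identityˡ _)))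

prime-*≈0 : ∀ {p} → Prime p → a * b ≈ 0ℤ [ p ] → a ≈ 0ℤ [ p ] ⊎ b ≈ 0ℤ [ p ]
prime-*≈0 {a} {b} {p} p-prime ab≈0
  with euclidsLemma ∣ a ∣ ∣ b ∣ p-prime (subst (p ℕ∣.∣_) (ℤ.abs-* a b) (≈0⇒∣ ab≈0))
... | inj₁ p∣a = inj₁ (∣⇒≈0 p∣a)
... | inj₂ p∣b = inj₂ (∣⇒≈0 p∣b)

≈⇒-≈0 : a ≈ b [ n ] → a - b ≈ 0ℤ [ n ]
≈⇒-≈0 {b = b} {n} (quot q refl) = quot q (lemma b (q * + n))
  where
  lemma : ∀ b t → b + t - b ≡ 0ℤ + t
  lemma = solve-∀

-≈0⇒≈ : a - b ≈ 0ℤ [ n ] → a ≈ b [ n ]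
-≈0⇒≈ {a} {b} p = ≈-trans (≈-reflexive (lemma₁ a b))
  (≈-trans (+-cong (≈-refl {b}) p) (≈-reflexive (lemma₂ b)))
  where
  lemma₁ : ∀ a b → a ≡ b + (a - b)
  lemma₁ = solve-∀
  lemma₂ : ∀ b → b + 0ℤ ≡ b
  lemma₂ = solve-∀

prime⇒1≉0 : ∀ {p} → Prime p → ¬ 1ℤ ≈ 0ℤ [ p ]
prime⇒1≉0 p-prime 1≈0 = ¬prime[1] (subst Prime (ℕ∣.∣1⇒≡1 (≈0⇒∣ 1≈0)) p-prime)

-- The monic polynomial with the given lower coefficients, constant term first.
eval : Vec ℤ n → ℤ → ℤ
eval Vec.[]       x = 1ℤ
eval (c Vec.∷ cs) x = c + x * eval cs x

-- Synthetic division by x - r: the Horner values at `r` are the coefficients of the quotient.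
deflate : Vec ℤ (suc n) → ℤ → Vec ℤ n
deflate (c Vec.∷ Vec.[])     r = Vec.[]
deflate (c Vec.∷ d Vec.∷ cs) r = eval (d Vec.∷ cs) r Vec.∷ deflate (d Vec.∷ cs) r

eval-deflate : ∀ (f : Vec ℤ (suc n)) x r → eval f x - eval f r ≡ (x - r) * eval (deflate f r) x
eval-deflate (c Vec.∷ Vec.[]) x r = lemma c x r
  where
  lemma : ∀ c x r → c + x * 1ℤ - (c + r * 1ℤ) ≡ (x - r) * 1ℤ
  lemma = solve-∀
eval-deflate (c Vec.∷ f@(_ Vec.∷ _)) x r = begin
  c + x * eval f x - (c + r * eval f r)               ≡⟨ lemma₁ c x r (eval f x) (eval f r) ⟩
  x * (eval f x - eval f r) + (x - r) * eval f r      ≡⟨ cong (λ t → x * t + (x - r) * eval f r) (eval-deflate f x r) ⟩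
  x * ((x - r) * q) + (x - r) * eval f r              ≡⟨ lemma₂ x r (eval f r) q ⟩
  (x - r) * (eval f r + x * q)                        ∎
  where
  open ≡-Reasoning
  q = eval (deflate f r) x
  lemma₁ : ∀ c x r e e′ → c + x * e - (c + r * e′) ≡ x * (e - e′) + (x - r) * e′
  lemma₁ = solve-∀
  lemma₂ : ∀ x r e q → x * ((x - r) * q) + (x - r) * e ≡ (x - r) * (e + x * q)
  lemma₂ = solve-∀

-- Divide by x - `r 0`. Primality sends every other root to the quotient, until the constant 1 would
-- have to vanish.
monic-roots : ∀ {p} → Prime p → (f : Vec ℤ n) (r : ℕ → ℤ) →
  (∀ i j → i < j → j ≤ n → ¬ r i ≈ r j [ p ]) →
  ¬ (∀ i → i ≤ n → eval f (r i) ≈ 0ℤ [ p ])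
monic-roots p-prime Vec.[] r distinct roots = prime⇒1≉0 p-prime (roots 0 z≤n)
monic-roots {p = p} p-prime f@(_ Vec.∷ _) r distinct roots =
  monic-roots p-prime (deflate f (r 0)) (r ∘ suc)
    (λ i j i<j j≤n → distinct (suc i) (suc j) (s≤s i<j) (s≤s j≤n))
    (λ i i≤n → go i i≤n (prime-*≈0 p-prime
      (≈-trans (≈-reflexive (sym (eval-deflate f (r (suc i)) (r 0))))
        (+-cong (roots (suc i) (s≤s i≤n)) (-‿cong (roots 0 z≤n))))))
  where
  go : ∀ i → i ≤ _ → r (suc i) - r 0 ≈ 0ℤ [ p ] ⊎ eval (deflate f (r 0)) (r (suc i)) ≈ 0ℤ [ p ] →
    eval (deflate f (r 0)) (r (suc i)) ≈ 0ℤ [ p ]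
  go i i≤n (inj₁ e) = ⊥-elim (distinct 0 (suc i) (s≤s z≤n) (s≤s i≤n) (≈-sym (-≈0⇒≈ e)))
  go i i≤n (inj₂ e) = e

unityPoly : ∀ n → Vec ℤ (suc n)
unityPoly n = -1ℤ Vec.∷ Vec.replicate n 0ℤ

eval-unityPoly : ∀ n x → eval (unityPoly n) x ≡ x ^ suc n - 1ℤ
eval-unityPoly n x = trans (cong (λ t → -1ℤ + x * t) (power n)) (ℤ.+-comm -1ℤ (x * x ^ n))
  where
  power : ∀ n → eval (Vec.replicate n 0ℤ) x ≡ x ^ n
  power zero    = refl
  power (suc n) = trans (ℤ.+-identityˡ _) (cong (x *_) (power n))

-- Gauss's lemma and the Legendre symbol

invertible-∏ : ∀ k (f : ℕ → ℤ) → (∀ i → i < k → Invertible n (f i)) → Invertible n (∏ k f)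
invertible-∏ zero    f inv = 1ℤ , ≈-refl
invertible-∏ (suc k) f inv = invertible-* (inv 0 (s≤s z≤n))
  (invertible-∏ k (f ∘ suc) (λ i i<k → inv (suc i) (s≤s i<k)))

small-invertible : ∀ h → Prime (odd h) → ∀ k → k < h → Invertible (odd h) (+ suc k)
small-invertible h p-prime k k<h = coprime⇒invertible (+ suc k)
  (Coprimality.sym (prime⇒coprime p-prime (ℕ.≤-<-trans k<h (h<odd h))))

-- The product of the ak over 1 ≤ k ≤ h is `a ^ h` times h!. It is also the product of the signs
-- times a permuted h!, and h! cancels.
gauss : ∀ h → Prime (odd h) → Invertible (odd h) a → a ^ h ≈ G h a [ odd h ]
gauss {a} h p-prime a-inv =
  invertible-cancel (invertible-∏ h (+_ ∘ suc) (small-invertible h p-prime)) (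
    ≈-trans (≈-reflexive lhs) (≈-trans (∏-cong-≈ h factor) (≈-reflexive rhs)))
  where
  factorial = ∏ h (+_ ∘ suc)
  f : ℕ → ℤ
  -- The value at 0 is replaced by 1, so that `∏-permute-μ`, whose range includes 0, can be applied
  -- to a factorial.
  f zero    = 1ℤ
  f (suc k) = + suc k
  lhs : factorial * a ^ h ≡ ∏ h (λ k → a * + suc k)
  lhs = trans (ℤ.*-comm factorial (a ^ h))
    (trans (cong (_* factorial) (sym (∏-const h a))) (sym (∏-distrib-* h (λ _ → a) (+_ ∘ suc))))
  f-nonzero : ∀ k → k ≢ 0 → f k ≡ + k
  f-nonzero zero    k≢0 = ⊥-elim (k≢0 refl)
  f-nonzero (suc k) k≢0 = refl
  factor : ∀ k → k < h → a * + suc k ≈ ε h (a * + suc k) * f (μ h (a * + suc k)) [ odd h ]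
  factor k k<h = ≈-trans (ε-*-μ h ak) (≈-reflexive (cong (ε h ak *_) (sym (f-nonzero (μ h ak) (λ e →
      invertible-*≉0 a-inv (small≉0 h k<h) (≈-trans (ε-*-μ h ak)
        (≈-reflexive (trans (cong (λ t → ε h ak * + t) e) (ℤ.*-zeroʳ (ε h ak))))))))))
    where ak = a * + suc k
  permuted : ∏ h (λ k → f (μ h (a * + suc k))) ≡ factorial
  permuted = begin
    ∏ h (λ k → f (μ h (a * + suc k)))          ≡⟨ sym (ℤ.*-identityˡ _) ⟩
    1ℤ * ∏ h (λ k → f (μ h (a * + suc k)))
      ≡⟨ cong (λ t → f t * ∏ h (λ k → f (μ h (a * + suc k))))
           (sym (μ-≈ h z≤n (inj₁ (≈-reflexive (ℤ.*-zeroʳ a))))) ⟩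
    ∏ (suc h) (λ k → f (μ h (a * + k)))        ≡⟨ ∏-permute-μ h a a-inv f ⟩
    1ℤ * factorial                             ≡⟨ ℤ.*-identityˡ factorial ⟩
    factorial                                  ∎
    where open ≡-Reasoning
  rhs : ∏ h (λ k → ε h (a * + suc k) * f (μ h (a * + suc k))) ≡ factorial * G h a
  rhs = trans (∏-distrib-* h (λ k → ε h (a * + suc k)) (λ k → f (μ h (a * + suc k))))
    (trans (cong₂ _*_ (sym (G-tail h a)) permuted) (ℤ.*-comm (G h a) factorial))

G-square : ∀ h → Invertible (odd h) a → G h (a * a) ≡ 1ℤ
G-square {a} h a-inv = trans (G-* h a-inv a-inv) (isSign-square (G-isSign h a))

-- A non-residue a with G h a ≡ 1 would be a root of x^h - 1 besides the h squares.
G-nonresidue : ∀ h → Prime (odd h) → Invertible (odd h) a →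
  (∀ k → k < h → ¬ a ≈ + suc k * + suc k [ odd h ]) → G h a ≡ -1ℤ
G-nonresidue zero p-prime = ⊥-elim (¬prime[1] p-prime)
G-nonresidue {a} h@(suc h-1) p-prime a-inv nonresidue with G-isSign h a
... | inj₂ G≡-1 = G≡-1
... | inj₁ G≡1  = ⊥-elim (monic-roots p-prime (unityPoly h-1) r distinct roots)
  where
  r : ℕ → ℤ
  r zero    = a
  r (suc k) = + suc k * + suc k
  root : ∀ {y} → Invertible (odd h) y → G h y ≡ 1ℤ → eval (unityPoly h-1) y ≈ 0ℤ [ odd h ]
  root {y} y-inv G≡1 = ≈-trans (≈-reflexive (eval-unityPoly h-1 y))
    (≈⇒-≈0 (≈-trans (gauss h p-prime y-inv) (≈-reflexive G≡1)))
  roots : ∀ i → i ≤ h → eval (unityPoly h-1) (r i) ≈ 0ℤ [ odd h ]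
  roots zero    _   = root a-inv G≡1
  roots (suc k) k<h = root (invertible-* k-inv k-inv) (G-square h k-inv)
    where k-inv = small-invertible h p-prime k k<h
  distinct : ∀ i j → i < j → j ≤ h → ¬ r i ≈ r j [ odd h ]
  distinct zero    (suc j) _   j<h e = nonresidue j j<h e
  -- The prime would divide the difference or the sum of two distinct numbers in {1, ..., h}, and
  -- both are nonzero and below 2h + 1 in size.
  distinct (suc i) (suc j) (s≤s i<j) j<h e
    with prime-*≈0 p-prime (≈-trans (≈-reflexive (lemma (+ suc i) (+ suc j))) (≈⇒-≈0 e))
    where
    lemma : ∀ i j → (i - j) * (i + j) ≡ i * i - j * j
    lemma = solve-∀
  ... | inj₁ e′ = ℕ.<⇒≢ i<j (ℕ.suc-injective (ℤ.+-injective
    (≈⇒≡-small h (ℕ.≤-trans (s≤s (ℕ.<⇒≤ i<j)) j<h) j<h (-≈0⇒≈ e′))))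
  ... | inj₂ e′ with () ← ≈⇒≡ {+ (suc i ℕ.+ suc j)} {0ℤ} (s≤s (subst (λ t → t ≤ 2 ℕ.* h)
          (sym (ℕ.+-identityʳ _)) (ℕ.+-mono-≤ (ℕ.≤-trans (s≤s (ℕ.<⇒≤ i<j)) j<h)
            (subst (suc j ≤_) (sym (ℕ.+-identityʳ h)) j<h)))) e′

legendre≡G : ∀ h → Prime (odd h) → Invertible (odd h) a → legendre a (odd h) ≡ G h a
legendre≡G {a} h p-prime a-inv = decide (r ≡ᵇ 0) (any square? (upTo p)) nonzero residue nonresidue
  where
  p = odd h
  r = a %ℕ p
  square? : ℕ → Bool
  square? y = ((y ℕ.* y) ℕ.% p) ≡ᵇ r
  -- The two tests of `legendre` become arbitrary Booleans, so the cases can be split apart from the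
  -- arithmetic.
  decide : ∀ b₁ b₂ → ¬ T b₁ → (T b₂ → G h a ≡ 1ℤ) → (¬ T b₂ → G h a ≡ -1ℤ) →
    (if b₁ then 0ℤ else if b₂ then 1ℤ else -1ℤ) ≡ G h a
  decide true  _     ¬b₁ _  _   = ⊥-elim (¬b₁ _)
  decide false true  _   b₂ _   = sym (b₂ _)
  decide false false _   _  ¬b₂ = sym (¬b₂ (λ ()))
  nonzero : ¬ T (r ≡ᵇ 0)
  nonzero r≡0 = invertible-*≉0 {b = 1ℤ} a-inv (prime⇒1≉0 p-prime)
    (≈-trans (≈-reflexive (ℤ.*-identityʳ a))
      (≈-trans (≈-% a p) (≈-reflexive (cong +_ (ℕ.≡ᵇ⇒≡ r 0 r≡0)))))
  residue : T (any square? (upTo p)) → G h a ≡ 1ℤ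
  residue t with y , y²≡r ← satisfied (any⁻ square? (upTo p) t) =
    trans (G-cong h a≈y²) (G-square {+ y} h (invertible-factorˡ {a = + y} {+ y} y²-inv))
    where
    a≈y² : a ≈ + y * + y [ p ]
    a≈y² = ≈-trans (≈-% a p) (≈-trans
      (≈-sym (≈-trans (≈-% (+ (y ℕ.* y)) p) (≈-reflexive (cong +_ (ℕ.≡ᵇ⇒≡ _ r y²≡r)))))
      (≈-reflexive (ℤ.pos-* y y)))
    y²-inv : Invertible p (+ y * + y)
    y²-inv = proj₁ a-inv , ≈-trans (*-congˡ (proj₁ a-inv) (≈-sym a≈y²)) (proj₂ a-inv)
  nonresidue : ¬ T (any square? (upTo p)) → G h a ≡ -1ℤ
  nonresidue none = G-nonresidue h p-prime a-inv (λ k k<h a≈k² → none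
    (any⁺ square? (lose {P = T ∘ square?} (∈-upTo⁺ (ℕ.≤-<-trans k<h (h<odd h))) (ℕ.≡⇒≡ᵇ _ r
      (%ℕ-unique {y = + (suc k ℕ.* suc k)} p (n%ℕd<d a p)
        (≈-trans (≈-reflexive (ℤ.pos-* (suc k) (suc k))) (≈-trans (≈-sym a≈k²) (≈-% a p))))))))

-- From prime moduli to the Jacobi symbol

even-or-odd : ∀ n → ∃ λ h → n ≡ 2 ℕ.* h ⊎ n ≡ odd h
even-or-odd zero = 0 , inj₁ refl
even-or-odd (suc n) with even-or-odd n
... | h , inj₁ refl = h , inj₂ refl
... | h , inj₂ refl = suc h , inj₁ (cong suc (sym (ℕ.+-suc h (h ℕ.+ 0))))

odd-factorˡ : ∀ m h → m ℕ.* n ≡ odd h → ∃ λ u → m ≡ odd u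
odd-factorˡ {n} m h eq with even-or-odd m
... | u , inj₂ e    = u , e
... | u , inj₁ refl = ⊥-elim (ℕ.even≢odd (u ℕ.* n) h (trans (sym (ℕ.*-assoc 2 u n)) eq))

odd-injective : ∀ {u v} → odd u ≡ odd v → u ≡ v
odd-injective {u} {v} e = ℕ.*-cancelˡ-≡ u v 2 (ℕ.suc-injective e)

-- Induction on the prime factors, with `G-modulus-*` splitting off the head. `F` is abstract and
-- known only by its two equations, since it stands for a local fold of `jacobi`.
multiplicative≡G : (F : List ℕ → ℤ) → F [] ≡ 1ℤ →
  (∀ p ps → F (suc p ∷ ps) ≡ legendre a (suc p) * F ps) →
  ∀ ps → All Prime ps → ∀ h → odd h ≡ product ps → Invertible (odd h) a → F ps ≡ G h a
multiplicative≡G {a} F F[] F∷ [] All.[] h e a-inv with refl ← odd-injective {h} {0} e =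
  trans F[] (sym (cong (_* 1ℤ) (ε-pos 0 z≤n (≈-reflexive (ℤ.*-zeroʳ a)))))
multiplicative≡G {a} F F[] F∷ (p ∷ ps) (p-prime All.∷ ps-prime) h e a-inv
  with u , refl ← odd-factorˡ p h (sym e)
  with v , e′ ← odd-factorˡ (product ps) h (trans (ℕ.*-comm (product ps) p) (sym e))
  with refl ← odd-injective {h} {half-* u v} (trans e (trans (cong (odd u ℕ.*_) e′) (sym (odd-half-* u v)))) =
  begin
    F (p ∷ ps)                      ≡⟨ F∷ (2 ℕ.* u) ps ⟩
    legendre a (odd u) * F ps
      ≡⟨ cong₂ _*_ (legendre≡G u p-prime (a⁻¹ , ≈-factorˡ (odd u) a⁻¹a≈1))
           (multiplicative≡G F F[] F∷ ps ps-prime v (sym e′) (a⁻¹ , ≈-factorʳ (odd u) a⁻¹a≈1)) ⟩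
    G u a * G v a                   ≡⟨ sym (G-modulus-* u v a-inv) ⟩
    G (half-* u v) a ∎
  where
  open ≡-Reasoning
  a⁻¹ = proj₁ a-inv
  a⁻¹a≈1 : a⁻¹ * a ≈ 1ℤ [ odd u ℕ.* odd v ]
  a⁻¹a≈1 = subst (a⁻¹ * a ≈ 1ℤ [_]) (odd-half-* u v) (proj₂ a-inv)

jacobi≡G : ∀ h → Invertible (odd h) a → jacobi a (odd h) ≡ G h a
jacobi≡G {a} h a-inv = go
  where
  -- The local function of jacobi has no accessible name; unification with the goal of go recovers it.
  F : List ℕ → ℤ
  F = _
  go : jacobi a (odd h) ≡ G h a
  go with factorise (odd h)
  ... | record { factors = ps ; isFactorisation = eq ; factorsPrime = ps-prime } =
    multiplicative≡G F refl (λ p ps → refl) ps ps-prime h eq a-inv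

-- Counts as products of signs

χ : Dec X → ℤ
χ (yes _) = -1ℤ
χ (no  _) = 1ℤ

χ-yes : (X? : Dec X) → X → χ X? ≡ -1ℤ
χ-yes (yes _) _ = refl
χ-yes (no ¬x) x = ⊥-elim (¬x x)

χ-no : (X? : Dec X) → ¬ X → χ X? ≡ 1ℤ
χ-no (yes x) ¬x = ⊥-elim (¬x x)
χ-no (no _)  _  = refl

sgn-filter : {P Q : Pred ℕ 0ℓ} (P? : Decidable P) (Q? : Decidable Q) (f : ℕ → ℕ) → ∀ n →
  sgn (length (filter P? (filter Q? (applyUpTo f n))))
    ≡ ∏ n (λ i → if does (Q? (f i)) then χ (P? (f i)) else 1ℤ)
sgn-filter P? Q? f zero = refl
sgn-filter P? Q? f (suc n) with Q? (f 0)
... | no _ = trans (sgn-filter P? Q? (f ∘ suc) n) (sym (ℤ.*-identityˡ _))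
... | yes _ with P? (f 0)
...   | yes _ = cong (-1ℤ *_) (sgn-filter P? Q? (f ∘ suc) n)
...   | no _  = trans (sgn-filter P? Q? (f ∘ suc) n) (sym (ℤ.*-identityˡ _))

sgn-countHalf : ∀ h {P : Pred ℕ 0ℓ} (P? : Decidable P) →
  sgn (countHalf (odd h) P P?) ≡ ∏ h (λ i → χ (P? (suc i)))
sgn-countHalf h P? = begin
  sgn (countHalf (odd h) _ P?)
    ≡⟨ cong (λ ks → sgn (length (filter P? (filter below? ks)))) (map-applyUpTo id suc (odd h)) ⟩
  sgn (length (filter P? (filter below? (applyUpTo suc (odd h)))))
    ≡⟨ sgn-filter P? below? suc (odd h) ⟩
  ∏ (odd h) f
    -- Index i stands for k = i + 1, so the cut k ≤ h comes after h indices and leaves h + 1 trivial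
    -- factors.
    ≡⟨ cong (λ n → ∏ n f) (trans (odd≡ h) (sym (ℕ.+-suc h h))) ⟩
  ∏ (h ℕ.+ suc h) f
    ≡⟨ ∏-split h (suc h) f ⟩
  ∏ h f * ∏ (suc h) (λ i → f (h ℕ.+ i))
    ≡⟨ cong₂ _*_ (∏-cong h low) (∏-one (suc h) high) ⟩
  ∏ h (λ i → χ (P? (suc i))) * 1ℤ
    ≡⟨ ℤ.*-identityʳ _ ⟩
  ∏ h (λ i → χ (P? (suc i))) ∎
  where
  open ≡-Reasoning
  below? : Decidable (λ k → 2 ℕ.* k < odd h)
  below? k = 2 ℕ.* k <? odd h
  f : ℕ → ℤ
  f i = if does (below? (suc i)) then χ (P? (suc i)) else 1ℤ
  low : ∀ i → i < h → f i ≡ χ (P? (suc i))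
  low i i<h = cong (if_then χ (P? (suc i)) else 1ℤ)
    (dec-true (below? (suc i)) (s≤s (ℕ.*-monoʳ-≤ 2 i<h)))
  high : ∀ i → i < suc h → f (h ℕ.+ i) ≡ 1ℤ
  high i _ = cong (if_then χ (P? (suc (h ℕ.+ i))) else 1ℤ)
    (dec-false (below? (suc (h ℕ.+ i)))
      (λ { (s≤s 2i≤n) → ℕ.<⇒≱ (s≤s (ℕ.m≤m+n h i)) (ℕ.*-cancelˡ-≤ 2 2i≤n) }))

ε≡χ : ∀ h y → ε h y ≡ χ (odd h <? 2 ℕ.* (y %ℕ odd h))
ε≡χ h y with (y %ℕ odd h) ≤? h
... | yes r≤h = sym (χ-no (odd h <? _) (ℕ.<⇒≯ (s≤s (ℕ.*-monoʳ-≤ 2 r≤h))))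
... | no  r≰h = trans (σ-- (+ (y %ℕ odd h)) (n%ℕd<d y (odd h)))
  (sym (χ-yes (odd h <? _) (ℕ.≤-trans (ℕ.≤-reflexive (cong suc (sym (ℕ.+-suc h (h ℕ.+ 0)))))
    (ℕ.*-monoʳ-≤ 2 (ℕ.≰⇒> r≰h)))))

-- Parity of a residue as a sign

sgn-+ : ∀ m n → sgn (m ℕ.+ n) ≡ sgn m * sgn n
sgn-+ = ℤ.^-distribˡ-+-* -1ℤ

sgn-double : ∀ m → sgn (2 ℕ.* m) ≡ 1ℤ
sgn-double m = trans (sym (ℤ.^-*-assoc -1ℤ 2 m)) (ℤ.^-zeroˡ m)

-- suc h is the inverse of 2 modulo odd h, so the sign of y / 2 is the parity of the residue of y.
half*2 : ∀ h → + suc h * + 2 ≈ 1ℤ [ odd h ]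
half*2 h = quot 1ℤ (trans (sym (ℤ.pos-* (suc h) 2))
  (trans (cong +_ (lemma h)) (cong (λ t → 1ℤ + t) (sym (ℤ.*-identityˡ (+ odd h))))))
  where
  lemma : ∀ h → suc h ℕ.* 2 ≡ suc (suc (2 ℕ.* h))
  lemma = ℕ-Ring.solve-∀

ε-half : ∀ h y → ε h (+ suc h * y) ≡ sgn (y %ℕ odd h)
ε-half h y = trans (ε-cong h (*-congˡ (+ suc h) (≈-% y (odd h)))) (go _ (n%ℕd<d y (odd h)))
  where
  go : ∀ r → r < odd h → ε h (+ suc h * + r) ≡ sgn r
  go r r<n with even-or-odd r
  go _ (s≤s 2t≤2h) | t , inj₁ refl = trans
    (ε-pos h (ℕ.*-cancelˡ-≤ 2 2t≤2h) (≈-trans (≈-reflexive lemma)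
      (≈-trans (*-congʳ (+ t) (half*2 h)) (≈-reflexive (ℤ.*-identityˡ (+ t))))))
    (sym (sgn-double t))
    where
    lemma : + suc h * + (2 ℕ.* t) ≡ + suc h * + 2 * + t
    lemma = trans (cong (+ suc h *_) (ℤ.pos-* 2 t)) (sym (ℤ.*-assoc (+ suc h) (+ 2) (+ t)))
  -- Half of 2t + 1 is t + (h + 1), congruent to t - h, which is negative because t < h.
  go _ (s≤s 2t<2h) | t , inj₂ refl = trans
    (cong σ (bal-unique h bound (≈-trans (≈-reflexive lemma)
      (≈-trans (+-cong (*-congʳ (+ t) (half*2 h)) (≈-refl {+ suc h})) (quot 1ℤ shift)))))
    (trans (σ-- (+ t) t<h) (sym (cong (-1ℤ *_) (sgn-double t))))
    where
    t<h : t < h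
    t<h = ℕ.*-cancelˡ-< 2 t h 2t<2h
    bound : ∣ + t - + h ∣ ≤ h
    bound = subst (λ z → ∣ z ∣ ≤ h) (sym (ℤ.m-n≡m⊖n t h))
      (ℕ.≤-trans (ℤ.∣m⊝n∣≤m⊔n t h) (ℕ.⊔-lub (ℕ.<⇒≤ t<h) ℕ.≤-refl))
    identity : ∀ c t → c * (1ℤ + + 2 * t) ≡ c * + 2 * t + c
    identity = solve-∀
    lemma : + suc h * + suc (2 ℕ.* t) ≡ + suc h * + 2 * + t + + suc h
    lemma = trans (cong (λ z → + suc h * (1ℤ + z)) (ℤ.pos-* 2 t)) (identity (+ suc h) (+ t))
    identity′ : ∀ t h → 1ℤ * t + (1ℤ + h) ≡ t - h + 1ℤ * (1ℤ + + 2 * h)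
    identity′ = solve-∀
    shift : 1ℤ * + t + + suc h ≡ + t - + h + 1ℤ * + odd h
    shift = trans (identity′ (+ t) (+ h)) (cong (λ z → + t - + h + 1ℤ * (1ℤ + z)) (sym (ℤ.pos-* 2 h)))

-- The joint position of {kx} and {k(1-x)}

≈⇒≡-ℕ : ∀ n .{{_ : NonZero n}} {k l} → k < n → l < n → + k ≈ + l [ n ] → k ≡ l
≈⇒≡-ℕ n k<n l<n k≈l = trans (sym (%ℕ-unique n k<n ≈-refl)) (%ℕ-unique n l<n k≈l)

residue-sum : ∀ n .{{_ : NonZero n}} {r s k} → r < n → s < n → k < n → + (r ℕ.+ s) ≈ + k [ n ] →
  r ℕ.+ s ≡ k ⊎ r ℕ.+ s ≡ n ℕ.+ k
residue-sum n {r} {s} {k} r<n s<n k<n r+s≈k with r ℕ.+ s <? n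
... | yes r+s<n = inj₁ (≈⇒≡-ℕ n r+s<n k<n r+s≈k)
... | no  r+s≮n = inj₂ (trans (sym n+t≡r+s) (cong (n ℕ.+_) (≈⇒≡-ℕ n t<n k<n t≈k)))
  where
  t = r ℕ.+ s ℕ.∸ n
  n+t≡r+s : n ℕ.+ t ≡ r ℕ.+ s
  n+t≡r+s = ℕ.m+[n∸m]≡n (ℕ.≮⇒≥ r+s≮n)
  t<n : t < n
  t<n = ℕ.+-cancelˡ-< n t n (subst (_< n ℕ.+ n) (sym n+t≡r+s) (ℕ.+-mono-< r<n s<n))
  t≈k : + t ≈ + k [ n ]
  t≈k = ≈-trans (≈-sym (quot 1ℤ (trans (cong +_ (trans (sym n+t≡r+s) (ℕ.+-comm n t)))
    (cong (λ z → + t + z) (sym (ℤ.*-identityˡ (+ n))))))) r+s≈k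

-- r and s stand for {kx} and {k(1-x)}.
data Position (n k r s : ℕ) : Set where
  small-small : 2 ℕ.* r < n → 2 ℕ.* s < n → ¬ k < r → Position n k r s
  small-large : 2 ℕ.* r < n → n < 2 ℕ.* s → k < r → Position n k r s
  large-small : n < 2 ℕ.* r → 2 ℕ.* s < n → k < r → Position n k r s
  large-large : n < 2 ℕ.* r → n < 2 ℕ.* s → k < r → Position n k r s

wraparound : ∀ {n k r s} → s < n → r ℕ.+ s ≡ n ℕ.+ k → k < r
wraparound {n} {k} {r} s<n r+s≡n+k = ℕ.+-cancelʳ-< n k r
  (subst (_< r ℕ.+ n) (trans r+s≡n+k (ℕ.+-comm n k)) (ℕ.+-monoʳ-< r s<n))

position : ∀ h {k r s} → k ≤ h → s < odd h →
  r ℕ.+ s ≡ k ⊎ r ℕ.+ s ≡ odd h ℕ.+ k → Position (odd h) k r s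
position h {k} {r} {s} k≤h _ (inj₁ refl) = small-small
  (s≤s (ℕ.*-monoʳ-≤ 2 (ℕ.≤-trans (ℕ.m≤m+n r s) k≤h)))
  (s≤s (ℕ.*-monoʳ-≤ 2 (ℕ.≤-trans (ℕ.m≤n+m s r) k≤h)))
  (ℕ.≤⇒≯ (ℕ.m≤m+n r s))
position h {k} {r} {s} _ s<n (inj₂ r+s≡n+k) = go (compare r) (compare s)
  where
  N : ℕ
  N = odd h
  compare : ∀ t → 2 ℕ.* t < N ⊎ N < 2 ℕ.* t
  compare t with t ≤? h
  ... | yes t≤h = inj₁ (s≤s (ℕ.*-monoʳ-≤ 2 t≤h))
  ... | no  t≰h = inj₂ (ℕ.≤-trans (ℕ.≤-reflexive (cong suc (sym (ℕ.+-suc h (h ℕ.+ 0)))))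
    (ℕ.*-monoʳ-≤ 2 (ℕ.≰⇒> t≰h)))
  k<r : k < r
  k<r = wraparound s<n r+s≡n+k
  go : 2 ℕ.* r < N ⊎ N < 2 ℕ.* r → 2 ℕ.* s < N ⊎ N < 2 ℕ.* s → Position N k r s
  go (inj₂ p) (inj₂ q) = large-large p q k<r
  go (inj₂ p) (inj₁ q) = large-small p q k<r
  go (inj₁ p) (inj₂ q) = small-large p q k<r
  -- Two residues below N/2 cannot add up to N + k.
  go (inj₁ p) (inj₁ q) = ⊥-elim (ℕ.<⇒≱ (ℕ.+-mono-< p q) (begin
    N ℕ.+ N                      ≤⟨ ℕ.+-mono-≤ (ℕ.m≤m+n N k) (ℕ.m≤m+n N k) ⟩
    (N ℕ.+ k) ℕ.+ (N ℕ.+ k)      ≡⟨ cong (λ t → t ℕ.+ t) (sym r+s≡n+k) ⟩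
    (r ℕ.+ s) ℕ.+ (r ℕ.+ s)      ≡⟨ lemma r s ⟩
    2 ℕ.* r ℕ.+ 2 ℕ.* s          ∎))
    where
    open ℕ.≤-Reasoning
    lemma : ∀ r s → (r ℕ.+ s) ℕ.+ (r ℕ.+ s) ≡ 2 ℕ.* r ℕ.+ 2 ℕ.* s
    lemma = ℕ-Ring.solve-∀

module _ {n k r s : ℕ} where

  -- Inclusion-exclusion modulo 2: k < r is the disjunction of the two large conditions, and
  -- [A and B] = [A] + [B] + [A or B].
  χ-large-large : Position n k r s →
    (A×B? : Dec (n < 2 ℕ.* r × n < 2 ℕ.* s))
    (A? : Dec (n < 2 ℕ.* r)) (B? : Dec (n < 2 ℕ.* s)) (C? : Dec (k < r)) →
    χ A×B? ≡ χ A? * χ B? * χ C?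
  χ-large-large (small-small p q c) A×B? A? B? C?
    rewrite χ-no A×B? (ℕ.<-asym p ∘ proj₁) | χ-no A? (ℕ.<-asym p) | χ-no B? (ℕ.<-asym q) | χ-no C? c = refl
  χ-large-large (small-large p q c) A×B? A? B? C?
    rewrite χ-no A×B? (ℕ.<-asym p ∘ proj₁) | χ-no A? (ℕ.<-asym p) | χ-yes B? q | χ-yes C? c = refl
  χ-large-large (large-small p q c) A×B? A? B? C?
    rewrite χ-no A×B? (ℕ.<-asym q ∘ proj₂) | χ-yes A? p | χ-no B? (ℕ.<-asym q) | χ-yes C? c = refl
  χ-large-large (large-large p q c) A×B? A? B? C?
    rewrite χ-yes A×B? (p , q) | χ-yes A? p | χ-yes B? q | χ-yes C? c = refl

  χ-small-small : Position n k r s →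
    (D? : Dec (2 ℕ.* r < n × 2 ℕ.* s < n)) (C? : Dec (k < r)) → χ D? ≡ -1ℤ * χ C?
  χ-small-small (small-small p q c) D? C? rewrite χ-yes D? (p , q) | χ-no C? c = refl
  χ-small-small (small-large p q c) D? C? rewrite χ-no D? (ℕ.<-asym q ∘ proj₂) | χ-yes C? c = refl
  χ-small-small (large-small p q c) D? C? rewrite χ-no D? (ℕ.<-asym p ∘ proj₁) | χ-yes C? c = refl
  χ-small-small (large-large p q c) D? C? rewrite χ-no D? (ℕ.<-asym p ∘ proj₁) | χ-yes C? c = refl

  -- Here "r large and s small" is the disjunction k < r with the cases of large s removed.
  χ-large-small : Position n k r s →
    (D? : Dec (n < 2 ℕ.* r × 2 ℕ.* s < n)) (B? : Dec (n < 2 ℕ.* s)) (C? : Dec (k < r)) →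
    χ D? ≡ χ B? * χ C?
  χ-large-small (small-small p q c) D? B? C?
    rewrite χ-no D? (ℕ.<-asym p ∘ proj₁) | χ-no B? (ℕ.<-asym q) | χ-no C? c = refl
  χ-large-small (small-large p q c) D? B? C?
    rewrite χ-no D? (ℕ.<-asym p ∘ proj₁) | χ-yes B? q | χ-yes C? c = refl
  χ-large-small (large-small p q c) D? B? C?
    rewrite χ-yes D? (p , q) | χ-no B? (ℕ.<-asym q) | χ-yes C? c = refl
  χ-large-small (large-large p q c) D? B? C?
    rewrite χ-no D? (ℕ.<-asym q ∘ proj₂) | χ-yes B? q | χ-yes C? c = refl

-- r + s + k is 2k or `odd h` + 2k, and the modulus is odd, so its parity records the wraparound.
χ-parity : ∀ h {k r s} → s < odd h → r ℕ.+ s ≡ k ⊎ r ℕ.+ s ≡ odd h ℕ.+ k →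
  (C? : Dec (k < r)) → χ C? ≡ sgn r * sgn s * sgn k
χ-parity h {_} {r} {s} _ (inj₁ refl) C? = trans (χ-no C? (ℕ.≤⇒≯ (ℕ.m≤m+n r s)))
  (sym (trans (cong (_* sgn (r ℕ.+ s)) (sym (sgn-+ r s))) (isSign-square (-1^-isSign (r ℕ.+ s)))))
χ-parity h {k} {r} {s} s<n (inj₂ r+s≡n+k) C? = trans (χ-yes C? (wraparound s<n r+s≡n+k)) (sym (begin
  sgn r * sgn s * sgn k         ≡⟨ cong (_* sgn k) (sym (sgn-+ r s)) ⟩
  sgn (r ℕ.+ s) * sgn k         ≡⟨ cong (λ t → sgn t * sgn k) r+s≡n+k ⟩
  sgn (odd h ℕ.+ k) * sgn k     ≡⟨ cong (_* sgn k) (sgn-+ (odd h) k) ⟩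
  sgn (odd h) * sgn k * sgn k   ≡⟨ ℤ.*-assoc (sgn (odd h)) (sgn k) (sgn k) ⟩
  sgn (odd h) * (sgn k * sgn k) ≡⟨ cong₂ _*_ (cong (-1ℤ *_) (sgn-double h)) (isSign-square (-1^-isSign k)) ⟩
  -1ℤ                           ∎))
  where open ≡-Reasoning

-- The four sign formulas

module _ (h : ℕ) (x : ℤ) (inv : Invertible (odd h) (x * (1ℤ - x))) where

  private
    N : ℕ
    N = odd h

    x′ : ℤ
    x′ = 1ℤ - x

    r s : ℕ → ℕ
    r k = res (+ k * x) N
    s k = res (+ k * x′) N

    x-inv : Invertible N x
    x-inv = invertible-factorˡ {a = x} {x′} inv

    x′-inv : Invertible N x′
    x′-inv = invertible-factorʳ {a = x} {x′} inv

    2-inv : Invertible N (+ 2)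
    2-inv = + suc h , half*2 h

    half-inv : Invertible N (+ suc h)
    half-inv = + 2 , ≈-trans (≈-reflexive (ℤ.*-comm (+ 2) (+ suc h))) (half*2 h)

    -- The arguments are mutually inverse, so the values multiply to 1; being signs, they agree.
    G-half : G h (+ suc h) ≡ G h (+ 2)
    G-half = begin
      G h (+ suc h)                              ≡⟨ sym (ℤ.*-identityʳ _) ⟩
      G h (+ suc h) * 1ℤ                         ≡⟨ cong (G h (+ suc h) *_) (sym (isSign-square (G-isSign h (+ 2)))) ⟩
      G h (+ suc h) * (G h (+ 2) * G h (+ 2))    ≡⟨ sym (ℤ.*-assoc (G h (+ suc h)) (G h (+ 2)) (G h (+ 2))) ⟩
      G h (+ suc h) * G h (+ 2) * G h (+ 2)      ≡⟨ cong (_* G h (+ 2)) (sym (G-* h half-inv 2-inv)) ⟩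
      G h (+ suc h * + 2) * G h (+ 2)            ≡⟨ cong (_* G h (+ 2)) (trans (G-cong h (half*2 h)) (G-1 h)) ⟩
      1ℤ * G h (+ 2)                             ≡⟨ ℤ.*-identityˡ _ ⟩
      G h (+ 2)                                  ∎
      where open ≡-Reasoning

    sums : ∀ {k} → k < h → r (suc k) ℕ.+ s (suc k) ≡ suc k ⊎ r (suc k) ℕ.+ s (suc k) ≡ N ℕ.+ suc k
    sums {k} k<h = residue-sum N (n%ℕd<d (+ suc k * x) N) (n%ℕd<d (+ suc k * x′) N)
      (ℕ.≤-<-trans k<h (h<odd h))
      (≈-trans (+-cong (≈-sym (≈-% (+ suc k * x) N)) (≈-sym (≈-% (+ suc k * x′) N)))
        (≈-reflexive (lemma (+ suc k) x)))
      where
      lemma : ∀ k x → k * x + k * (1ℤ - x) ≡ k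
      lemma = solve-∀

    positions : ∀ {k} → k < h → Position N (suc k) (r (suc k)) (s (suc k))
    positions {k} k<h = position h k<h (n%ℕd<d (+ suc k * x′) N) (sums k<h)

    ∏-χ-large : ∀ y → ∏ h (λ k → χ (N <? 2 ℕ.* res (+ suc k * y) N)) ≡ G h y
    ∏-χ-large y = trans
      (∏-cong h (λ k _ → trans (sym (ε≡χ h (+ suc k * y))) (cong (ε h) (ℤ.*-comm (+ suc k) y))))
      (sym (G-tail h y))

    ∏-sgn-res : ∀ y → Invertible N y → ∏ h (λ k → sgn (res (+ suc k * y) N)) ≡ G h (+ 2) * G h y
    ∏-sgn-res y y-inv = begin
      ∏ h (λ k → sgn (res (+ suc k * y) N))
        ≡⟨ ∏-cong h (λ k _ → trans (sym (ε-half h (+ suc k * y))) (cong (ε h) (lemma (+ suc h) (+ suc k) y))) ⟩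
      ∏ h (λ k → ε h (+ suc h * y * + suc k))
        ≡⟨ sym (G-tail h (+ suc h * y)) ⟩
      G h (+ suc h * y)
        ≡⟨ G-* h half-inv y-inv ⟩
      G h (+ suc h) * G h y
        ≡⟨ cong (_* G h y) G-half ⟩
      G h (+ 2) * G h y ∎
      where
      open ≡-Reasoning
      lemma : ∀ c k y → c * (k * y) ≡ c * y * k
      lemma = solve-∀

    ∏-sgn : ∏ h (λ k → sgn (suc k)) ≡ G h (+ 2)
    ∏-sgn = begin
      ∏ h (λ k → sgn (suc k))
        -- Each k ≤ h is its own residue, so this is the case y = 1 of `∏-sgn-res`.
        ≡⟨ ∏-cong h (λ k k<h → cong sgn (sym (%ℕ-unique {y = + suc k * 1ℤ} N (ℕ.≤-<-trans k<h (h<odd h))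
             (≈-reflexive (ℤ.*-identityʳ (+ suc k)))))) ⟩
      ∏ h (λ k → sgn (res (+ suc k * 1ℤ) N))   ≡⟨ ∏-sgn-res 1ℤ (1ℤ , ≈-refl) ⟩
      G h (+ 2) * G h 1ℤ                       ≡⟨ cong (G h (+ 2) *_) (G-1 h) ⟩
      G h (+ 2) * 1ℤ                           ≡⟨ ℤ.*-identityʳ _ ⟩
      G h (+ 2)                                ∎
      where open ≡-Reasoning

    g₂ gₓ gₓ′ : ℤ
    g₂  = G h (+ 2)
    gₓ  = G h x
    gₓ′ = G h x′

    ∏-χ-rise : ∏ h (λ k → χ (suc k <? r (suc k))) ≡ g₂ * gₓ * gₓ′
    ∏-χ-rise = begin
      ∏ h (λ k → χ (suc k <? r (suc k)))
        ≡⟨ ∏-cong h (λ k k<h → χ-parity h (n%ℕd<d (+ suc k * x′) N) (sums k<h) (suc k <? r (suc k))) ⟩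
      ∏ h (λ k → sgn (r (suc k)) * sgn (s (suc k)) * sgn (suc k))
        ≡⟨ trans (∏-distrib-* h (λ k → sgn (r (suc k)) * sgn (s (suc k))) (λ k → sgn (suc k)))
             (cong₂ _*_ (∏-distrib-* h (λ k → sgn (r (suc k))) (λ k → sgn (s (suc k)))) ∏-sgn) ⟩
      ∏ h (λ k → sgn (r (suc k))) * ∏ h (λ k → sgn (s (suc k))) * g₂
        ≡⟨ cong₂ (λ t u → t * u * g₂) (∏-sgn-res x x-inv) (∏-sgn-res x′ x′-inv) ⟩
      -- One `g₂` comes from each of r, s and k; two of the three cancel.
      g₂ * gₓ * (g₂ * gₓ′) * g₂
        ≡⟨ lemma g₂ gₓ gₓ′ ⟩
      g₂ * g₂ * (g₂ * gₓ * gₓ′)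
        ≡⟨ cong (_* (g₂ * gₓ * gₓ′)) (isSign-square (G-isSign h (+ 2))) ⟩
      1ℤ * (g₂ * gₓ * gₓ′)
        ≡⟨ ℤ.*-identityˡ _ ⟩
      g₂ * gₓ * gₓ′ ∎
      where
      open ≡-Reasoning
      lemma : ∀ t x y → t * x * (t * y) * t ≡ t * t * (t * x * y)
      lemma = solve-∀

    2x-inv : Invertible N (+ 2 * x)
    2x-inv = invertible-* 2-inv x-inv

    2xx′-inv : Invertible N (+ 2 * x * x′)
    2xx′-inv = invertible-* 2x-inv x′-inv

    G-2x : G h (+ 2 * x) ≡ g₂ * gₓ
    G-2x = G-* h 2-inv x-inv

    G-2xx′ : G h (+ 2 * x * x′) ≡ g₂ * gₓ * gₓ′
    G-2xx′ = trans (G-* h 2x-inv x′-inv) (cong (_* gₓ′) G-2x)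

  sign-rise : sgn (countHalf (odd h) _ (λ k → k <? res (+ k * x) (odd h)))
    ≡ jacobi (+ 2 * x * (1ℤ - x)) (odd h)
  sign-rise = trans (sgn-countHalf h (λ k → k <? r k))
    (trans ∏-χ-rise (sym (trans (jacobi≡G h 2xx′-inv) G-2xx′)))

  sign-large-large : sgn (countHalf (odd h) _ (λ k →
      (odd h <? 2 ℕ.* res (+ k * x) (odd h)) ×-dec (odd h <? 2 ℕ.* res (+ k * (1ℤ - x)) (odd h))))
    ≡ jacobi (+ 2) (odd h)
  sign-large-large = begin
    sgn (countHalf N _ (λ k → A? k ×-dec B? k))
      ≡⟨ sgn-countHalf h (λ k → A? k ×-dec B? k) ⟩
    ∏ h (λ k → χ (A? (suc k) ×-dec B? (suc k)))
      ≡⟨ ∏-cong h (λ k k<h → χ-large-large (positions k<h) (A? (suc k) ×-dec B? (suc k))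
           (A? (suc k)) (B? (suc k)) (suc k <? r (suc k))) ⟩
    ∏ h (λ k → χ (A? (suc k)) * χ (B? (suc k)) * χ (suc k <? r (suc k)))
      ≡⟨ trans (∏-distrib-* h (λ k → χ (A? (suc k)) * χ (B? (suc k))) (λ k → χ (suc k <? r (suc k))))
           (cong₂ _*_ (trans (∏-distrib-* h (λ k → χ (A? (suc k))) (λ k → χ (B? (suc k))))
             (cong₂ _*_ (∏-χ-large x) (∏-χ-large x′))) ∏-χ-rise) ⟩
    gₓ * gₓ′ * (g₂ * gₓ * gₓ′)
      ≡⟨ lemma g₂ gₓ gₓ′ ⟩
    gₓ * gₓ * (gₓ′ * gₓ′) * g₂
      ≡⟨ cong₂ (λ t u → t * u * g₂) (isSign-square (G-isSign h x)) (isSign-square (G-isSign h x′)) ⟩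
    1ℤ * g₂
      ≡⟨ ℤ.*-identityˡ g₂ ⟩
    g₂
      ≡⟨ sym (jacobi≡G h 2-inv) ⟩
    jacobi (+ 2) N ∎
    where
    open ≡-Reasoning
    A? : ∀ k → Dec (N < 2 ℕ.* r k)
    A? k = N <? 2 ℕ.* r k
    B? : ∀ k → Dec (N < 2 ℕ.* s k)
    B? k = N <? 2 ℕ.* s k
    lemma : ∀ t x y → x * y * (t * x * y) ≡ x * x * (y * y) * t
    lemma = solve-∀

  sign-small-small : sgn (countHalf (odd h) _ (λ k →
      (2 ℕ.* res (+ k * x) (odd h) <? odd h) ×-dec (2 ℕ.* res (+ k * (1ℤ - x)) (odd h) <? odd h)))
    ≡ jacobi (+ 2 * x * (x - 1ℤ)) (odd h)
  sign-small-small = begin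
    sgn (countHalf N _ D?)
      ≡⟨ sgn-countHalf h D? ⟩
    ∏ h (λ k → χ (D? (suc k)))
      ≡⟨ ∏-cong h (λ k k<h → χ-small-small (positions k<h) (D? (suc k)) (suc k <? r (suc k))) ⟩
    ∏ h (λ k → -1ℤ * χ (suc k <? r (suc k)))
      ≡⟨ ∏-distrib-* h (λ _ → -1ℤ) (λ k → χ (suc k <? r (suc k))) ⟩
    ∏ h (λ _ → -1ℤ) * ∏ h (λ k → χ (suc k <? r (suc k)))
      -- Complementing the condition for each of the h indices costs (-1)^h, which is `G h -1ℤ`; it
      -- turns 1 - x into x - 1.
      ≡⟨ cong₂ _*_ (trans (∏-const h -1ℤ) (sym (G-[-1] h))) (trans ∏-χ-rise (sym G-2xx′)) ⟩
    G h -1ℤ * G h (+ 2 * x * x′)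
      ≡⟨ sym (G-* h -1-inv 2xx′-inv) ⟩
    G h (-1ℤ * (+ 2 * x * x′))
      ≡⟨ sym (jacobi≡G h (invertible-* -1-inv 2xx′-inv)) ⟩
    jacobi (-1ℤ * (+ 2 * x * x′)) N
      ≡⟨ cong (λ t → jacobi t N) (lemma x) ⟩
    jacobi (+ 2 * x * (x - 1ℤ)) N ∎
    where
    open ≡-Reasoning
    D? : ∀ k → Dec (2 ℕ.* r k < N × 2 ℕ.* s k < N)
    D? k = (2 ℕ.* r k <? N) ×-dec (2 ℕ.* s k <? N)
    -1-inv : Invertible N -1ℤ
    -1-inv = -1ℤ , ≈-refl
    lemma : ∀ x → -1ℤ * (+ 2 * x * (1ℤ - x)) ≡ + 2 * x * (x - 1ℤ)
    lemma = solve-∀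

  sign-large-small : sgn (countHalf (odd h) _ (λ k →
      (odd h <? 2 ℕ.* res (+ k * x) (odd h)) ×-dec (2 ℕ.* res (+ k * (1ℤ - x)) (odd h) <? odd h)))
    ≡ jacobi (+ 2 * x) (odd h)
  sign-large-small = begin
    sgn (countHalf N _ D?)
      ≡⟨ sgn-countHalf h D? ⟩
    ∏ h (λ k → χ (D? (suc k)))
      ≡⟨ ∏-cong h (λ k k<h → χ-large-small (positions k<h) (D? (suc k)) (N <? 2 ℕ.* s (suc k)) (suc k <? r (suc k))) ⟩
    ∏ h (λ k → χ (N <? 2 ℕ.* s (suc k)) * χ (suc k <? r (suc k)))
      ≡⟨ ∏-distrib-* h (λ k → χ (N <? 2 ℕ.* s (suc k))) (λ k → χ (suc k <? r (suc k))) ⟩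
    ∏ h (λ k → χ (N <? 2 ℕ.* s (suc k))) * ∏ h (λ k → χ (suc k <? r (suc k)))
      ≡⟨ cong₂ _*_ (∏-χ-large x′) ∏-χ-rise ⟩
    gₓ′ * (g₂ * gₓ * gₓ′)
      ≡⟨ lemma g₂ gₓ gₓ′ ⟩
    gₓ′ * gₓ′ * (g₂ * gₓ)
      ≡⟨ cong (_* (g₂ * gₓ)) (isSign-square (G-isSign h x′)) ⟩
    1ℤ * (g₂ * gₓ)
      ≡⟨ ℤ.*-identityˡ (g₂ * gₓ) ⟩
    g₂ * gₓ
      ≡⟨ sym (trans (jacobi≡G h 2x-inv) G-2x) ⟩
    jacobi (+ 2 * x) N ∎
    where
    open ≡-Reasoning
    D? : ∀ k → Dec (N < 2 ℕ.* r k × 2 ℕ.* s k < N)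
    D? k = (N <? 2 ℕ.* r k) ×-dec (2 ℕ.* s k <? N)
    lemma : ∀ t x y → y * (t * x * y) ≡ y * y * (t * x)
    lemma = solve-∀

theorem1p1 : (n : ℕ) .{{_ : NonZero n}} → n ℕ.% 2 ≡ 1 → (x : ℤ) →
    Coprime ℤ.∣ x ℤ.* (1ℤ ℤ.- x) ∣ n →
    (sgn (countHalf n (λ k → k < res (+ k ℤ.* x) n) (λ k → k <? res (+ k ℤ.* x) n))
    ≡ jacobi (+ 2 ℤ.* x ℤ.* (1ℤ ℤ.- x)) n)
    × (sgn (countHalf n (λ k → (n < 2 ℕ.* res (+ k ℤ.* x) n) × (n < 2 ℕ.* res (+ k ℤ.* (1ℤ ℤ.- x)) n))
    (λ k → (n <? 2 ℕ.* res (+ k ℤ.* x) n) ×-dec (n <? 2 ℕ.* res (+ k ℤ.* (1ℤ ℤ.- x)) n)))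
    ≡ jacobi (+ 2) n)
    × (sgn (countHalf n (λ k → (2 ℕ.* res (+ k ℤ.* x) n < n) × (2 ℕ.* res (+ k ℤ.* (1ℤ ℤ.- x)) n < n))
    (λ k → (2 ℕ.* res (+ k ℤ.* x) n <? n) ×-dec (2 ℕ.* res (+ k ℤ.* (1ℤ ℤ.- x)) n <? n)))
    ≡ jacobi (+ 2 ℤ.* x ℤ.* (x ℤ.- 1ℤ)) n)
    × (sgn (countHalf n (λ k → (n < 2 ℕ.* res (+ k ℤ.* x) n) × (2 ℕ.* res (+ k ℤ.* (1ℤ ℤ.- x)) n < n))
    (λ k → (n <? 2 ℕ.* res (+ k ℤ.* x) n) ×-dec (2 ℕ.* res (+ k ℤ.* (1ℤ ℤ.- x)) n <? n)))
    ≡ jacobi (+ 2 ℤ.* x) n)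
theorem1p1 n n%2≡1 x coprime with even-or-odd n
... | h , inj₁ refl with () ← trans (sym n%2≡1) (trans (cong (ℕ._% 2) (ℕ.*-comm 2 h)) (ℕ.m*n%n≡0 h 2))
... | h , inj₂ refl =
  sign-rise h x inv , sign-large-large h x inv , sign-small-small h x inv , sign-large-small h x inv
  where
  inv : Invertible (odd h) (x * (1ℤ - x))
  inv = coprime⇒invertible (x * (1ℤ - x)) coprime
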